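{- For all integers $L\geq 1$ and $n\geq 0$, $$ \sum_{m\geq 0}\binom{m}{2}a_2(L,m,n)\ \geq\ \sum_{m\geq 0}\binom{m}{2}b_2(2L,m,n). $$
   Context: The hook length of a cell in the Young diagram of a partition is one plus the number of cells to its right in the same row plus the number of cells below it in the same column. A hook of length two means a cell whose hook length equals $2$. For integers $L\ge 1$ and $m,n\ge 0$: $a_2(L,m,n)$ is the number of partitions of $n$ into odd parts (repetitions allowed), each at most $2L-1$, having exactly $m$ hooks of length two; $b_2(L,m,n)$ is the number of partitions of $n$ into distinct parts, each at most $L$, having exactly $m$ hooks of length two. Thus $b_2(2L,m,n)$ concerns distinct parts at most $2L$. -}

module Defs where

open import Data.List.Base using (List; []; _∷_; _++_; map; filter; length; upTo; cartesianProductWith)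
open import Data.List.Membership.Propositional using (_∈_)
open import Data.List.Membership.Propositional.Properties using (∈-filter⁺; ∈-filter⁻; ∈-cartesianProductWith⁺; ∈-cartesianProductWith⁻; ∈-upTo⁺)
open import Data.List.Properties using (length-++; length-map; length-upTo; length-filter; filter-none; ∷-injective)
open import Data.List.Relation.Unary.All as All using (All; []; _∷_; all?)
open import Data.List.Relation.Unary.AllPairs using ([]; _∷_)
open import Data.List.Relation.Unary.Any using (here; there)
open import Data.List.Relation.Unary.Linked using (Linked; linked?)
open import Data.List.Relation.Unary.Unique.Propositional using (Unique)
import Data.List.Relation.Unary.Unique.Propositional.Properties as Uniqueₚ
open import Data.Nat.Base using (ℕ; zero; suc; _+_; _*_; _∸_; _≤_; _<_; _≥_; z≤n; s≤s)
open import Data.Nat.Combinatorics using (_C_)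
open import Data.Nat.ListAction using (sum)
open import Data.Nat.Divisibility using (_∤_; _∣?_)
open import Data.Nat.Properties using (_≟_; _≤?_; _<?_; _≥?_; ≤-trans; ≤-reflexive; +-mono-≤; m≤m+n; m≤n+m; <⇒≱; *-zeroʳ)
open import Data.List.Relation.Unary.Unique.DecPropositional _≟_ using (unique?)
open import Data.Product.Base using (_×_; _,_; proj₂; ∃; ∃₂)
open import Relation.Binary.PropositionalEquality using (_≡_; _≢_; refl; cong; cong₂; trans)
open import Relation.Nullary.Decidable using (¬?; _×-dec_)
open import Relation.Nullary.Negation using (¬_)
open import Relation.Unary using (Pred; Decidable)
open import Level using (0ℓ)

IsPartition : ℕ → Pred (List ℕ) 0ℓ
IsPartition n λs = Linked _≥_ λs × All (0 <_) λs × sum λs ≡ n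

isPartition? : ∀ n → Decidable (IsPartition n)
isPartition? n λs = linked? _≥?_ λs ×-dec all? (0 <?_) λs ×-dec (sum λs ≟ n)

-- All lists of length at most ℓ with entries at most k.
words : (k ℓ : ℕ) → List (List ℕ)
words k zero    = [] ∷ []
words k (suc ℓ) = [] ∷ cartesianProductWith _∷_ (upTo (suc k)) (words k ℓ)

-- A partition of n has at most n parts, each at most n, so this search is
-- exhaustive; see partitions-sound, partitions-complete, partitions-unique.
partitions : ℕ → List (List ℕ)
partitions n = filter (isPartition? n) (words n n)

-- The cells of λs are the pairs (i , j), counted from 0, with j < λᵢ.  For a
-- cell in column j of a row of length r, followed by the rows μs below it:
arm : (r j : ℕ) → ℕ
arm r j = r ∸ suc j

leg : (μs : List ℕ) (j : ℕ) → ℕ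
leg μs j = length (filter (j <?_) μs)

hookLength : (r : ℕ) (μs : List ℕ) (j : ℕ) → ℕ
hookLength r μs j = 1 + arm r j + leg μs j

-- One entry per cell of the diagram.
hookLengths : List ℕ → List ℕ
hookLengths []       = []
hookLengths (r ∷ μs) = map (hookLength r μs) (upTo r) ++ hookLengths μs

hooks₂ : List ℕ → ℕ
hooks₂ λs = length (filter (_≟ 2) (hookLengths λs))

OddParts≤ : ℕ → Pred (List ℕ) 0ℓ
OddParts≤ k λs = All (2 ∤_) λs × All (_≤ k) λs

oddParts≤? : ∀ k → Decidable (OddParts≤ k)
oddParts≤? k λs = all? (λ x → ¬? (2 ∣? x)) λs ×-dec all? (_≤? k) λs

DistinctParts≤ : ℕ → Pred (List ℕ) 0ℓ
DistinctParts≤ k λs = Unique λs × All (_≤ k) λs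

distinctParts≤? : ∀ k → Decidable (DistinctParts≤ k)
distinctParts≤? k λs = unique? λs ×-dec all? (_≤? k) λs

-- The number of partitions of n that satisfy P and have exactly m hooks of
-- length two.
count : {P : Pred (List ℕ) 0ℓ} → Decidable P → (m n : ℕ) → ℕ
count P? m n = length (filter (λ λs → P? λs ×-dec (hooks₂ λs ≟ m)) (partitions n))

a₂ : (L m n : ℕ) → ℕ
a₂ L = count (oddParts≤? (2 * L ∸ 1))

b₂ : (L m n : ℕ) → ℕ
b₂ L = count (distinctParts≤? L)

FinitelySupported : (ℕ → ℕ) → Set
FinitelySupported f = ∃ λ N → ∀ m → N < m → f m ≡ 0

-- The sum of f over all natural numbers; it does not depend on the bound
-- chosen in the proof of finite support.
∑ : (f : ℕ → ℕ) → FinitelySupported f → ℕ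
∑ f (N , _) = sum (map f (upTo (suc N)))

partitions-sound : ∀ {n λs} → λs ∈ partitions n → IsPartition n λs
partitions-sound {n} λs∈ = proj₂ (∈-filter⁻ (isPartition? n) {xs = words n n} λs∈)

words-complete : ∀ {k ℓ λs} → All (_≤ k) λs → length λs ≤ ℓ → λs ∈ words k ℓ
words-complete {ℓ = zero}  []       _        = here refl
words-complete {ℓ = suc ℓ} []       _        = here refl
words-complete {ℓ = suc ℓ} (p ∷ ps) (s≤s q) =
  there (∈-cartesianProductWith⁺ _∷_ (∈-upTo⁺ (s≤s p)) (words-complete ps q))

parts≤sum : ∀ λs → All (_≤ sum λs) λs
parts≤sum []       = []
parts≤sum (x ∷ λs) =
  m≤m+n x (sum λs) ∷ All.map (λ p → ≤-trans p (m≤n+m (sum λs) x)) (parts≤sum λs)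

length≤sum : ∀ {λs} → All (0 <_) λs → length λs ≤ sum λs
length≤sum []       = z≤n
length≤sum (p ∷ ps) = +-mono-≤ p (length≤sum ps)

partitions-complete : ∀ {n λs} → IsPartition n λs → λs ∈ partitions n
partitions-complete {λs = λs} p@(_ , pos , refl) =
  ∈-filter⁺ (isPartition? _) (words-complete (parts≤sum λs) (length≤sum pos)) p

words-unique : ∀ k ℓ → Unique (words k ℓ)
words-unique k zero    = [] ∷ []
words-unique k (suc ℓ) =
  nonempty (upTo (suc k)) ∷
  Uniqueₚ.cartesianProductWith⁺ _∷_ ∷-injective (Uniqueₚ.upTo⁺ (suc k)) (words-unique k ℓ)
  where
  nonempty : ∀ xs → All {A = List ℕ} ([] ≢_) (cartesianProductWith _∷_ xs (words k ℓ))
  nonempty xs = All.tabulate λ { ∈xs refl → []∉ (∈-cartesianProductWith⁻ _∷_ xs (words k ℓ) ∈xs) }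
    where
    []∉ : ∀ {as bs} → ¬ (∃₂ λ (x : ℕ) (λs : List ℕ) → x ∈ as × λs ∈ bs × [] ≡ x ∷ λs)
    []∉ (_ , _ , _ , _ , ())

partitions-unique : ∀ n → Unique (partitions n)
partitions-unique n = Uniqueₚ.filter⁺ (isPartition? n) (words-unique n n)

length-hookLengths : ∀ λs → length (hookLengths λs) ≡ sum λs
length-hookLengths []       = refl
length-hookLengths (r ∷ μs) =
  trans (length-++ (map (hookLength r μs) (upTo r)))
        (cong₂ _+_ (trans (length-map (hookLength r μs) (upTo r)) (length-upTo r))
                   (length-hookLengths μs))

hooks₂≤sum : ∀ λs → hooks₂ λs ≤ sum λs
hooks₂≤sum λs = ≤-trans (length-filter (_≟ 2) (hookLengths λs)) (≤-reflexive (length-hookLengths λs))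

count-vanishes : ∀ {P : Pred (List ℕ) 0ℓ} (P? : Decidable P) n m → n < m → count P? m n ≡ 0
count-vanishes P? n m n<m = cong length (filter-none _ (All.tabulate tooMany))
  where
  tooMany : ∀ {λs} → λs ∈ partitions n → ¬ (_ × hooks₂ λs ≡ m)
  tooMany {λs} λs∈ (_ , refl) with partitions-sound {n} λs∈
  ... | _ , _ , refl = <⇒≱ n<m (hooks₂≤sum λs)

weighted-support : ∀ (w : ℕ → ℕ) {P : Pred (List ℕ) 0ℓ} (P? : Decidable P) n →
                   FinitelySupported (λ m → w m * count P? m n)
weighted-support w P? n =
  n , λ m n<m → trans (cong (w m *_) (count-vanishes P? n m n<m)) (*-zeroʳ (w m))

a₂-support : ∀ L n → FinitelySupported (λ m → (m C 2) * a₂ L m n)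
a₂-support L n = weighted-support (_C 2) (oddParts≤? (2 * L ∸ 1)) n

b₂-support : ∀ L n → FinitelySupported (λ m → (m C 2) * b₂ L m n)
b₂-support L n = weighted-support (_C 2) (distinctParts≤? L) n

{-# OPTIONS --safe #-}
module Submission where

-- A part s contributes a hook of length two if it occurs at least twice, and
-- another one if s ≥ 2 and s - 1 is not a part.  Writing the two sides as
-- generating functions in q, the right-hand side is exactly
--   q^6 [2L-2 choose 2]_q ∏_{3 ≤ i ≤ 2L-2} (1 + q^i),
-- and the left-hand side is ∏_{s odd, s < 2L} (1 - q^s)^(-1) times
--   E = e₂(y_1, y_3, …, y_{2L-1}) + ∑_{s odd, 3 ≤ s < 2L} q^(2s),
-- where y_1 = q^2 and y_s = q^s + q^(2s) for s ≥ 3.  By induction on L,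
-- q^6 [2L-2 choose 2]_q ≤ (1 + q)(1 + q^2) E coefficientwise; by Glaisher's
-- identity the product of the 1 + q^i is at most
-- (1 - q^4)^(-1) ∏_{s odd, 3 ≤ s < 2L-2} (1 - q^s)^(-1); and
-- (1 + q)(1 + q^2) / (1 - q^4) = 1 / (1 - q).

open import Defs
open import Algebra.Bundles using (CommutativeSemiring)
open import Algebra.Structures using (IsCommutativeMonoid)
open import Algebra.Structures.Biased using (isCommutativeSemiringˡ; isCommutativeMonoidˡ)
open import Data.Nat using (ℕ; zero; suc; _+_; _*_; _∸_; _≤_; _<_; _≥_; z≤n; s≤s)
open import Data.Nat.Properties
open import Data.Nat.Divisibility using (_∣_; _∤_; _∣?_; >⇒∤; _∣0; ∣m+n∣m⇒∣n; ∣m∣n⇒∣m+n; ∣-refl)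
open import Data.Nat.Combinatorics using (_C_; nCk+nC[k+1]≡[n+1]C[k+1]; nC1≡n)
open import Data.Nat.ListAction using (sum)
open import Data.List.Base using (List; []; _∷_; _++_; map; filter; length; upTo; applyUpTo; replicate; cartesianProductWith)
open import Data.List.Membership.Propositional using (_∈_)
open import Data.List.Membership.Propositional.Properties using (∈-++⁺ˡ; ∈-++⁺ʳ; ∈-++⁻; ∈-map⁺; ∈-map⁻; ∈-upTo⁻; ∈-∃++; ∈-filter⁺; ∈-filter⁻)
open import Data.List.Properties using (map-++; map-∘; map-cong-local; length-++; ∷-injectiveʳ; filter-++; filter-none; filter-accept; filter-reject; upTo-∷ʳ; map-upTo)
open import Data.List.Relation.Unary.All as All using (All; []; _∷_)
import Data.List.Relation.Unary.All.Properties as All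
open import Data.List.Relation.Unary.AllPairs using (AllPairs; []; _∷_)
open import Data.List.Relation.Unary.Linked.Properties using (AllPairs⇒Linked; Linked⇒AllPairs)
open import Data.List.Relation.Unary.Unique.Propositional using (Unique)
import Data.List.Relation.Unary.Unique.Propositional.Properties as Unique
open import Data.Nat.ListAction.Properties using (sum-↭)
open import Data.Product.Base using (_×_; _,_; proj₁; proj₂)
open import Data.Sum.Base using (inj₁; inj₂)
open import Data.Vec.Base using (Vec; []; _∷_)
import Data.Vec.Properties as Vec
import Data.List.Relation.Binary.Permutation.Propositional.Properties as Perm
open import Data.List.Relation.Unary.Any using (here; there)
open import Data.Bool.Base using (if_then_else_)
open import Relation.Nullary.Decidable using (Dec; does; yes; no; _×-dec_; dec-true; dec-false)
open import Relation.Nullary.Negation using (¬_; contradiction)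
open import Data.Nat.Solver using (module +-*-Solver)
open import Function.Base using (_∘_; id)
open import Level using (0ℓ)
open import Relation.Binary.Bundles using (Preorder)
open import Relation.Unary using (Pred; Decidable)
import Relation.Binary.Reasoning.Preorder as PreorderReasoning
import Relation.Binary.Reasoning.Setoid as SetoidReasoning
open import Relation.Binary.Structures using (IsEquivalence)
open import Relation.Binary.PropositionalEquality
  using (_≡_; _≢_; refl; sym; ≢-sym; trans; cong; cong₂; subst; module ≡-Reasoning)

-- The factor (1 + q)(1 + q^2) is essential: for L = 3 the coefficient of q^9 is 1 in q^6
-- [4 choose 2]_q but 0 in E. It is available because Glaisher's identity leaves 1/(1 - q^4) where
-- the odd side has 1/(1 - q). The induction adds the odd part s = 2L - 1. With p = q^s, the
-- Gaussian side grows by p q^2 (1 + q) [2L-4]_q + p^2, and E grows by y_s (y_1 + ... + y_(s-2)) +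
-- p^2, the p^2 being the pair of hooks that a repeated s owns by itself. What remains is a
-- comparison of degree one, q^2 (1 + q) [2L-4]_q against (1 + q)(1 + q^2)(y_1 + ... + y_(s-2)).
-- Everything is an inequality in one direction: the distinct side is bounded above by a sum over an
-- explicit list, the odd side below by a sum over multiplicity vectors. For these to be finitely
-- many, multiplicities are capped, and so series are compared only up to the degree n in question.

C₂-suc : ∀ n → suc n C 2 ≡ n + n C 2
C₂-suc n = trans (sym (nCk+nC[k+1]≡[n+1]C[k+1] n 1)) (cong (_+ n C 2) (nC1≡n n))

-- Vandermonde's identity in degree two. It sorts pairs of hooks by how many of the two lie in the
-- copies of the largest part.
C₂-+ : ∀ m n → (m + n) C 2 ≡ m C 2 + m * n + n C 2
C₂-+ zero    n = refl
C₂-+ (suc m) n = begin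
  suc (m + n) C 2                           ≡⟨ C₂-suc (m + n) ⟩
  m + n + (m + n) C 2                       ≡⟨ cong (m + n +_) (C₂-+ m n) ⟩
  m + n + (m C 2 + m * n + n C 2)           ≡⟨ solve 5 (λ m n a b c →
                                                 m :+ n :+ (a :+ b :+ c) := m :+ a :+ (n :+ b) :+ c)
                                                 refl m n (m C 2) (m * n) (n C 2) ⟩
  m + m C 2 + (n + m * n) + n C 2           ≡⟨ cong (λ a → a + (n + m * n) + n C 2) (C₂-suc m) ⟨
  suc m C 2 + suc m * n + n C 2             ∎
  where
  open ≡-Reasoning
  open +-*-Solver

-- The commutative semiring of power series over the natural numbers.

Series : Set
Series = ℕ → ℕ

infix  4 _≈_
infixl 6 _⊕_
infixl 7 _⊛_ _·_

-- A record rather than bare pointwise equality, so that unification can recover the two series.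
record _≈_ (f g : Series) : Set where
  constructor coeffwise
  field coeff : ∀ n → f n ≡ g n

open _≈_

𝟘 𝟙 q : Series
𝟘 _ = 0
𝟙 zero    = 1
𝟙 (suc _) = 0
q zero    = 0
q (suc n) = 𝟙 n

-- The Cauchy product comes from f = f 0 + q (f ∘ suc), which gives a structural recursion on the
-- degree.
_⊕_ _⊛_ : Series → Series → Series
(f ⊕ g) n = f n + g n
(f ⊛ g) zero    = f 0 * g 0
(f ⊛ g) (suc n) = f 0 * g (suc n) + (f ∘ suc ⊛ g) n

_·_ : ℕ → Series → Series
(c · f) n = c * f n

module _ where
  open ≡-Reasoning
  open +-*-Solver

  ⊛-cong : ∀ {f f′ g g′ : Series} → (∀ n → f n ≡ f′ n) → (∀ n → g n ≡ g′ n) →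
           ∀ n → (f ⊛ g) n ≡ (f′ ⊛ g′) n
  ⊛-cong p q zero    = cong₂ _*_ (p 0) (q 0)
  ⊛-cong p q (suc n) = cong₂ _+_ (cong₂ _*_ (p 0) (q (suc n))) (⊛-cong (p ∘ suc) q n)

  ⊛-zeroˡ : ∀ f n → (𝟘 ⊛ f) n ≡ 0
  ⊛-zeroˡ f zero    = refl
  ⊛-zeroˡ f (suc n) = ⊛-zeroˡ f n

  ⊛-identityˡ : ∀ f n → (𝟙 ⊛ f) n ≡ f n
  ⊛-identityˡ f zero    = *-identityˡ (f 0)
  ⊛-identityˡ f (suc n) = begin
    1 * f (suc n) + (𝟘 ⊛ f) n ≡⟨ cong₂ _+_ (*-identityˡ (f (suc n))) (⊛-zeroˡ f n) ⟩
    f (suc n) + 0             ≡⟨ +-identityʳ _ ⟩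
    f (suc n)                 ∎

  ⊛-distribʳ : ∀ f g h n → ((g ⊕ h) ⊛ f) n ≡ (g ⊛ f ⊕ h ⊛ f) n
  ⊛-distribʳ f g h zero    = *-distribʳ-+ (f 0) (g 0) (h 0)
  ⊛-distribʳ f g h (suc n) = begin
    (g 0 + h 0) * f (suc n) + ((g ∘ suc ⊕ h ∘ suc) ⊛ f) n
      ≡⟨ cong ((g 0 + h 0) * f (suc n) +_) (⊛-distribʳ f (g ∘ suc) (h ∘ suc) n) ⟩
    (g 0 + h 0) * f (suc n) + ((g ∘ suc ⊛ f) n + (h ∘ suc ⊛ f) n)
      ≡⟨ solve 5 (λ a b c d e → (a :+ b) :* c :+ (d :+ e) := a :* c :+ d :+ (b :* c :+ e))
               refl (g 0) (h 0) (f (suc n)) ((g ∘ suc ⊛ f) n) ((h ∘ suc ⊛ f) n) ⟩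
    (g ⊛ f ⊕ h ⊛ f) (suc n) ∎

  -- The mirror image of the defining equation, peeling the constant term off the right factor;
  -- commutativity rests on it.
  ⊛-suc : ∀ f g n → (f ⊛ g) (suc n) ≡ (f ⊛ g ∘ suc) n + f (suc n) * g 0
  ⊛-suc f g zero    = refl
  ⊛-suc f g (suc n) = begin
    f 0 * g (2 + n) + (f ∘ suc ⊛ g) (suc n)
      ≡⟨ cong (f 0 * g (2 + n) +_) (⊛-suc (f ∘ suc) g n) ⟩
    f 0 * g (2 + n) + ((f ∘ suc ⊛ g ∘ suc) n + f (2 + n) * g 0)
      ≡⟨ sym (+-assoc (f 0 * g (2 + n)) _ _) ⟩
    (f ⊛ g ∘ suc) (suc n) + f (2 + n) * g 0 ∎

  ⊛-comm : ∀ f g n → (f ⊛ g) n ≡ (g ⊛ f) n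
  ⊛-comm f g zero    = *-comm (f 0) (g 0)
  ⊛-comm f g (suc n) = begin
    f 0 * g (suc n) + (f ∘ suc ⊛ g) n ≡⟨ cong₂ _+_ (*-comm (f 0) _) (⊛-comm (f ∘ suc) g n) ⟩
    g (suc n) * f 0 + (g ⊛ f ∘ suc) n ≡⟨ +-comm (g (suc n) * f 0) _ ⟩
    (g ⊛ f ∘ suc) n + g (suc n) * f 0 ≡⟨ sym (⊛-suc g f n) ⟩
    (g ⊛ f) (suc n)                   ∎

  ·-⊛ : ∀ c f g n → ((c · f) ⊛ g) n ≡ (c · (f ⊛ g)) n
  ·-⊛ c f g zero    = *-assoc c (f 0) (g 0)
  ·-⊛ c f g (suc n) = begin
    c * f 0 * g (suc n) + ((c · (f ∘ suc)) ⊛ g) n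
      ≡⟨ cong₂ _+_ (*-assoc c (f 0) _) (·-⊛ c (f ∘ suc) g n) ⟩
    c * (f 0 * g (suc n)) + c * (f ∘ suc ⊛ g) n
      ≡⟨ sym (*-distribˡ-+ c _ _) ⟩
    (c · (f ⊛ g)) (suc n) ∎

  ⊛-assoc : ∀ f g h n → ((f ⊛ g) ⊛ h) n ≡ (f ⊛ (g ⊛ h)) n
  ⊛-assoc f g h zero    = *-assoc (f 0) (g 0) (h 0)
  ⊛-assoc f g h (suc n) = begin
    f 0 * g 0 * h (suc n) + (((f 0 · (g ∘ suc)) ⊕ (f ∘ suc ⊛ g)) ⊛ h) n
      ≡⟨ cong (f 0 * g 0 * h (suc n) +_) (⊛-distribʳ h (f 0 · (g ∘ suc)) (f ∘ suc ⊛ g) n) ⟩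
    f 0 * g 0 * h (suc n) + (((f 0 · (g ∘ suc)) ⊛ h) n + ((f ∘ suc ⊛ g) ⊛ h) n)
      ≡⟨ cong (f 0 * g 0 * h (suc n) +_) (cong₂ _+_ (·-⊛ (f 0) (g ∘ suc) h n) (⊛-assoc (f ∘ suc) g h n)) ⟩
    f 0 * g 0 * h (suc n) + (f 0 * (g ∘ suc ⊛ h) n + (f ∘ suc ⊛ (g ⊛ h)) n)
      ≡⟨ solve 5 (λ a b c d e → a :* b :* c :+ (a :* d :+ e) := a :* (b :* c :+ d) :+ e)
               refl (f 0) (g 0) (h (suc n)) ((g ∘ suc ⊛ h) n) ((f ∘ suc ⊛ (g ⊛ h)) n) ⟩
    (f ⊛ (g ⊛ h)) (suc n) ∎

series : CommutativeSemiring 0ℓ 0ℓ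
series = record
  { _≈_ = _≈_ ; _+_ = _⊕_ ; _*_ = _⊛_ ; 0# = 𝟘 ; 1# = 𝟙
  ; isCommutativeSemiring = isCommutativeSemiringˡ record
    { +-isCommutativeMonoid = ⊕-isCommutativeMonoid
    ; *-isCommutativeMonoid = isCommutativeMonoidˡ record
      { isSemigroup = record
        { isMagma = record
          { isEquivalence = ≈-isEquivalence
          ; ∙-cong = λ p q → coeffwise (⊛-cong (coeff p) (coeff q)) }
        ; assoc = λ f g h → coeffwise (⊛-assoc f g h) }
      ; identityˡ = λ f → coeffwise (⊛-identityˡ f)
      ; comm = λ f g → coeffwise (⊛-comm f g) }
    ; distribʳ = λ f g h → coeffwise (⊛-distribʳ f g h)
    ; zeroˡ = λ f → coeffwise (⊛-zeroˡ f) } }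
  where
  ≈-isEquivalence : IsEquivalence _≈_
  ≈-isEquivalence = record
    { refl  = coeffwise λ _ → refl
    ; sym   = λ p → coeffwise λ n → sym (coeff p n)
    ; trans = λ p q → coeffwise λ n → trans (coeff p n) (coeff q n) }
  ⊕-isCommutativeMonoid : IsCommutativeMonoid _≈_ _⊕_ 𝟘
  ⊕-isCommutativeMonoid = isCommutativeMonoidˡ record
    { isSemigroup = record
      { isMagma = record
        { isEquivalence = ≈-isEquivalence
        ; ∙-cong = λ p q → coeffwise λ n → cong₂ _+_ (coeff p n) (coeff q n) }
      ; assoc = λ f g h → coeffwise λ n → +-assoc (f n) (g n) (h n) }
    ; identityˡ = λ f → coeffwise λ _ → refl
    ; comm = λ f g → coeffwise λ n → +-comm (f n) (g n) }

open CommutativeSemiring series using (setoid) renaming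
  (refl to ≈-refl; sym to ≈-sym; trans to ≈-trans; +-cong to ⊕-cong; *-cong to ⊛≈-cong)
module ≈-Reasoning = SetoidReasoning setoid
open import Algebra.Solver.Ring.NaturalCoefficients.Default series using (solve; Polynomial; _:+_; _:*_; _:=_; con)

-- Powers of `q`, Gaussian binomials and closed forms for the distinct side.

X : ℕ → Series
X zero    = 𝟙
X (suc n) = q ⊛ X n

-- Unlike `2 * n`, this produces both successors by computation, so `X (double (suc n))` unfolds to
-- two factors `q`.
double : ℕ → ℕ
double zero    = zero
double (suc n) = suc (suc (double n))

-- For a literal k, X (k + n) unfolds to k factors q and X n; (k ▹ p) q is this
-- product in the syntax of the solver.
_▹_ : ∀ {n} → ℕ → Polynomial n → Polynomial n → Polynomial n
(zero  ▹ a) q = a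
(suc k ▹ a) q = q :* (k ▹ a) q

module _ where
  open ≈-Reasoning

  X-+ : ∀ m n → X (m + n) ≈ X m ⊛ X n
  X-+ zero    n = solve 1 (λ p → p := con 1 :* p) ≈-refl (X n)
  X-+ (suc m) n = begin
    q ⊛ X (m + n)   ≈⟨ ⊛≈-cong ≈-refl (X-+ m n) ⟩
    q ⊛ (X m ⊛ X n) ≈⟨ solve 3 (λ q a b → q :* (a :* b) := q :* a :* b) ≈-refl q (X m) (X n) ⟩
    q ⊛ X m ⊛ X n   ∎

  X-double : ∀ n → X (double n) ≈ X n ⊛ X n
  X-double zero    = solve 0 (con 1 := con 1 :* con 1) ≈-refl
  X-double (suc n) = begin
    q ⊛ (q ⊛ X (double n)) ≈⟨ ⊛≈-cong ≈-refl (⊛≈-cong ≈-refl (X-double n)) ⟩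
    q ⊛ (q ⊛ (X n ⊛ X n))  ≈⟨ solve 2 (λ q a → q :* (q :* (a :* a)) := q :* a :* (q :* a)) ≈-refl q (X n) ⟩
    q ⊛ X n ⊛ (q ⊛ X n)    ∎

  -- The q-integer 1 + q + ... + q^(n-1).
  bracket : ℕ → Series
  bracket zero    = 𝟘
  bracket (suc n) = bracket n ⊕ X n

  bracket-suc : ∀ n → bracket (suc n) ≈ 𝟙 ⊕ q ⊛ bracket n
  bracket-suc zero    = solve 1 (λ q → con 0 :+ con 1 := con 1 :+ q :* con 0) ≈-refl q
  bracket-suc (suc n) = begin
    bracket (suc n) ⊕ X (suc n)    ≈⟨ ⊕-cong (bracket-suc n) ≈-refl ⟩
    𝟙 ⊕ q ⊛ bracket n ⊕ q ⊛ X n    ≈⟨ solve 3 (λ q b p → con 1 :+ q :* b :+ q :* p := con 1 :+ q :* (b :+ p))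
                                        ≈-refl q (bracket n) (X n) ⟩
    𝟙 ⊕ q ⊛ (bracket n ⊕ X n)      ∎

  -- The Gaussian binomial coefficient of j + 2 over 2.
  binom₂ : ℕ → Series
  binom₂ zero    = 𝟙
  binom₂ (suc j) = binom₂ j ⊕ X (1 + j) ⊛ bracket (2 + j)

  -- The second q-Pascal rule, the first being the definition. `D₂-closed` uses both: its step
  -- splits into `binom₂ (suc j)` in the first form plus `X (3 + j)` times the same in the second
  -- form.
  binom₂-suc : ∀ j → binom₂ (suc j) ≈ X 2 ⊛ binom₂ j ⊕ bracket (2 + j)
  binom₂-suc zero = solve 1 (λ q →
    con 1 :+ (1 ▹ con 1) q :* (con 0 :+ con 1 :+ (1 ▹ con 1) q) :=
    (2 ▹ con 1) q :* con 1 :+ (con 0 :+ con 1 :+ (1 ▹ con 1) q)) ≈-refl q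
  binom₂-suc (suc j) = begin
    binom₂ (suc j) ⊕ X (2 + j) ⊛ bracket (3 + j)
      ≈⟨ ⊕-cong (binom₂-suc j) (⊛≈-cong ≈-refl (bracket-suc (2 + j))) ⟩
    X 2 ⊛ binom₂ j ⊕ bracket (2 + j) ⊕ X (2 + j) ⊛ (𝟙 ⊕ q ⊛ bracket (2 + j))
      ≈⟨ solve 4 (λ q B b p →
           (2 ▹ con 1) q :* B :+ b :+ (2 ▹ p) q :* (con 1 :+ q :* b) :=
           (2 ▹ con 1) q :* (B :+ (1 ▹ p) q :* b) :+ (b :+ (2 ▹ p) q))
         ≈-refl q (binom₂ j) (bracket (2 + j)) (X j) ⟩
    X 2 ⊛ (binom₂ j ⊕ X (1 + j) ⊛ bracket (2 + j)) ⊕ (bracket (2 + j) ⊕ X (2 + j)) ∎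

  -- The product of 1 + q^i for 3 ≤ i ≤ j + 2.
  ρ : ℕ → Series
  ρ zero    = 𝟙
  ρ (suc j) = ρ j ⊛ (𝟙 ⊕ X (3 + j))

  -- Let D(k; t) enumerate the partitions into distinct parts ≤ k with weight t
  -- to the number of hooks of length two.  Then
  -- D(k) = (1 + q^k) D(k - 1) + (t - 1) q^k D(k - 2) for k ≥ 2, and Dᵢ is the
  -- coefficient of (t - 1)^i.
  D₀ D₁ D₂ : ℕ → Series
  D₀ zero    = 𝟙
  D₀ (suc k) = (𝟙 ⊕ X (1 + k)) ⊛ D₀ k
  D₁ zero          = 𝟘
  D₁ (suc zero)    = 𝟘
  D₁ (suc (suc k)) = (𝟙 ⊕ X (2 + k)) ⊛ D₁ (suc k) ⊕ X (2 + k) ⊛ D₀ k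
  D₂ zero          = 𝟘
  D₂ (suc zero)    = 𝟘
  D₂ (suc (suc k)) = (𝟙 ⊕ X (2 + k)) ⊛ D₂ (suc k) ⊕ X (2 + k) ⊛ D₁ k

  D₀-closed : ∀ j → D₀ (2 + j) ≈ (𝟙 ⊕ X 1) ⊛ (𝟙 ⊕ X 2) ⊛ ρ j
  D₀-closed zero = solve 1 (λ q →
    (con 1 :+ (2 ▹ con 1) q) :* ((con 1 :+ (1 ▹ con 1) q) :* con 1) :=
    (con 1 :+ (1 ▹ con 1) q) :* (con 1 :+ (2 ▹ con 1) q) :* con 1) ≈-refl q
  D₀-closed (suc j) = begin
    (𝟙 ⊕ X (3 + j)) ⊛ D₀ (2 + j)
      ≈⟨ ⊛≈-cong ≈-refl (D₀-closed j) ⟩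
    (𝟙 ⊕ X (3 + j)) ⊛ ((𝟙 ⊕ X 1) ⊛ (𝟙 ⊕ X 2) ⊛ ρ j)
      ≈⟨ solve 4 (λ a b c r → a :* (b :* c :* r) := b :* c :* (r :* a)) ≈-refl _ _ _ _ ⟩
    (𝟙 ⊕ X 1) ⊛ (𝟙 ⊕ X 2) ⊛ (ρ j ⊛ (𝟙 ⊕ X (3 + j))) ∎

  -- The product lags behind: the recurrence multiplies by 1 + q^(j+4), the closed form gains 1 +
  -- q^(j+3). The `D₀` summand makes up the difference and lengthens the q-integer. `D₂-closed` lags
  -- by one more.
  D₁-closed : ∀ j → D₁ (3 + j) ≈ X 2 ⊛ bracket (2 + j) ⊛ (𝟙 ⊕ X 2) ⊛ ρ j
  D₁-closed zero = solve 1 (λ q →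
    (con 1 :+ (3 ▹ con 1) q) :* ((con 1 :+ (2 ▹ con 1) q) :* con 0 :+ (2 ▹ con 1) q :* con 1)
      :+ (3 ▹ con 1) q :* ((con 1 :+ (1 ▹ con 1) q) :* con 1) :=
    (2 ▹ con 1) q :* (con 0 :+ con 1 :+ (1 ▹ con 1) q) :* (con 1 :+ (2 ▹ con 1) q) :* con 1) ≈-refl q
  D₁-closed (suc j) = begin
    (𝟙 ⊕ X (4 + j)) ⊛ D₁ (3 + j) ⊕ X (4 + j) ⊛ D₀ (2 + j)
      ≈⟨ ⊕-cong (⊛≈-cong ≈-refl (D₁-closed j)) (⊛≈-cong ≈-refl (D₀-closed j)) ⟩
    (𝟙 ⊕ X (4 + j)) ⊛ (X 2 ⊛ (b ⊕ X (1 + j)) ⊛ (𝟙 ⊕ X 2) ⊛ ρ j)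
      ⊕ X (4 + j) ⊛ ((𝟙 ⊕ X 1) ⊛ (𝟙 ⊕ X 2) ⊛ ρ j)
      ≈⟨ solve 4 (λ q b p r →
           (con 1 :+ (4 ▹ p) q) :* ((2 ▹ con 1) q :* (b :+ (1 ▹ p) q) :* (con 1 :+ (2 ▹ con 1) q) :* r)
             :+ (4 ▹ p) q :* ((con 1 :+ (1 ▹ con 1) q) :* (con 1 :+ (2 ▹ con 1) q) :* r) :=
           (2 ▹ con 1) q :* ((b :+ (1 ▹ p) q :+ (2 ▹ p) q)
             :+ (3 ▹ p) q :* (con 1 :+ q :* (b :+ (1 ▹ p) q))) :* (con 1 :+ (2 ▹ con 1) q) :* r)
         ≈-refl q b (X j) (ρ j) ⟩
    X 2 ⊛ (bracket (3 + j) ⊕ X (3 + j) ⊛ (𝟙 ⊕ q ⊛ bracket (2 + j))) ⊛ (𝟙 ⊕ X 2) ⊛ ρ j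
      ≈⟨ ⊛≈-cong (⊛≈-cong (⊛≈-cong ≈-refl (⊕-cong ≈-refl (⊛≈-cong ≈-refl (bracket-suc (2 + j))))) ≈-refl) ≈-refl ⟨
    X 2 ⊛ (bracket (3 + j) ⊕ X (3 + j) ⊛ bracket (3 + j)) ⊛ (𝟙 ⊕ X 2) ⊛ ρ j
      ≈⟨ solve 5 (λ a b p c r → a :* (b :+ p :* b) :* c :* r := a :* b :* c :* (r :* (con 1 :+ p))) ≈-refl
           (X 2) (bracket (3 + j)) (X (3 + j)) (𝟙 ⊕ X 2) (ρ j) ⟩
    X 2 ⊛ bracket (3 + j) ⊛ (𝟙 ⊕ X 2) ⊛ (ρ j ⊛ (𝟙 ⊕ X (3 + j))) ∎
    where b = bracket (1 + j)

  D₂-closed : ∀ j → D₂ (4 + j) ≈ X 6 ⊛ binom₂ j ⊛ ρ j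
  D₂-closed zero = solve 1 (λ q →
    (con 1 :+ (4 ▹ con 1) q) :* ((con 1 :+ (3 ▹ con 1) q) :*
        ((con 1 :+ (2 ▹ con 1) q) :* con 0 :+ (2 ▹ con 1) q :* con 0) :+ (3 ▹ con 1) q :* con 0)
      :+ (4 ▹ con 1) q :* ((con 1 :+ (2 ▹ con 1) q) :* con 0 :+ (2 ▹ con 1) q :* con 1) :=
    (6 ▹ con 1) q :* con 1 :* con 1) ≈-refl q
  D₂-closed (suc j) = begin
    (𝟙 ⊕ X (5 + j)) ⊛ D₂ (4 + j) ⊕ X (5 + j) ⊛ D₁ (3 + j)
      ≈⟨ ⊕-cong (⊛≈-cong ≈-refl (D₂-closed j)) (⊛≈-cong ≈-refl (D₁-closed j)) ⟩
    (𝟙 ⊕ X (5 + j)) ⊛ (X 6 ⊛ binom₂ j ⊛ ρ j) ⊕ X (5 + j) ⊛ (X 2 ⊛ bracket (2 + j) ⊛ (𝟙 ⊕ X 2) ⊛ ρ j)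
      ≈⟨ solve 5 (λ q B b p r →
           (con 1 :+ (5 ▹ p) q) :* ((6 ▹ con 1) q :* B :* r)
             :+ (5 ▹ p) q :* ((2 ▹ con 1) q :* b :* (con 1 :+ (2 ▹ con 1) q) :* r) :=
           (6 ▹ con 1) q :* (B :+ (1 ▹ p) q :* b :+ (3 ▹ p) q :* ((2 ▹ con 1) q :* B :+ b)) :* r)
         ≈-refl q (binom₂ j) (bracket (2 + j)) (X j) (ρ j) ⟩
    X 6 ⊛ (binom₂ (suc j) ⊕ X (3 + j) ⊛ (X 2 ⊛ binom₂ j ⊕ bracket (2 + j))) ⊛ ρ j
      ≈⟨ ⊛≈-cong (⊛≈-cong ≈-refl (⊕-cong ≈-refl (⊛≈-cong ≈-refl (binom₂-suc j)))) ≈-refl ⟨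
    X 6 ⊛ (binom₂ (suc j) ⊕ X (3 + j) ⊛ binom₂ (suc j)) ⊛ ρ j
      ≈⟨ solve 4 (λ a B p r → a :* (B :+ p :* B) :* r := a :* B :* (r :* (con 1 :+ p))) ≈-refl
           (X 6) (binom₂ (suc j)) (X (3 + j)) (ρ j) ⟩
    X 6 ⊛ binom₂ (suc j) ⊛ (ρ j ⊛ (𝟙 ⊕ X (3 + j))) ∎

-- Geometric series and Glaisher's identity.

X-coeff-< : ∀ {m n} f → n < m → (X m ⊛ f) n ≡ 0
X-coeff-< {suc m} {zero}  f _ = refl
X-coeff-< {suc m} {suc n} f (s≤s n<m) =
  trans (trans (⊛-assoc q (X m) f (suc n)) (⊛-identityˡ (X m ⊛ f) n)) (X-coeff-< f n<m)

X-coeff-+ : ∀ m f n → (X m ⊛ f) (m + n) ≡ f n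
X-coeff-+ zero    f n = ⊛-identityˡ f n
X-coeff-+ (suc m) f n =
  trans (trans (⊛-assoc q (X m) f (suc (m + n))) (⊛-identityˡ (X m ⊛ f) (m + n))) (X-coeff-+ m f n)

geo : ℕ → Series
geo s n = if does (s ∣? n) then 1 else 0

geo-∣ : ∀ {s n} → s ∣ n → geo s n ≡ 1
geo-∣ {s} {n} s∣n = cong (if_then 1 else 0) (dec-true (s ∣? n) s∣n)

geo-∤ : ∀ {s n} → ¬ s ∣ n → geo s n ≡ 0
geo-∤ {s} {n} s∤n = cong (if_then 1 else 0) (dec-false (s ∣? n) s∤n)

geo-+ : ∀ s n → geo s (s + n) ≡ geo s n
geo-+ s n with s ∣? n
... | yes s∣n = geo-∣ (∣m∣n⇒∣m+n ∣-refl s∣n)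
... | no  s∤n = geo-∤ (λ s∣s+n → s∤n (∣m+n∣m⇒∣n s∣s+n ∣-refl))

geo-unfold : ∀ s → geo (suc s) ≈ 𝟙 ⊕ X (suc s) ⊛ geo (suc s)
geo-unfold s = coeffwise go
  where
  go : ∀ n → geo (suc s) n ≡ (𝟙 ⊕ X (suc s) ⊛ geo (suc s)) n
  go zero    = geo-∣ (suc s ∣0)
  go (suc n) with suc n <? suc s
  ... | yes n<s = trans (geo-∤ (>⇒∤ n<s)) (sym (X-coeff-< (geo (suc s)) n<s))
  ... | no  n≮s = subst (λ m → geo (suc s) m ≡ (X (suc s) ⊛ geo (suc s)) m)
                    (m+[n∸m]≡n (≮⇒≥ n≮s))
                    (trans (geo-+ (suc s) k) (sym (X-coeff-+ (suc s) (geo (suc s)) k)))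
    where k = suc n ∸ suc s

⊕-cancelˡ : ∀ {f g h} → h ⊕ f ≈ h ⊕ g → f ≈ g
⊕-cancelˡ {h = h} p = coeffwise λ n → +-cancelˡ-≡ (h n) _ _ (coeff p n)

module _ where
  open ≈-Reasoning

  -- Expanding `f ⊛ g` by the equation of `g` and by that of `f` leaves the common summand
  -- `p ⊛ (f ⊛ g)`, which cancels.
  geo-unique : ∀ {s f} → f ≈ 𝟙 ⊕ X (suc s) ⊛ f → f ≈ geo (suc s)
  geo-unique {s} {f} f-unfold = ⊕-cancelˡ {h = p ⊛ (f ⊛ g)} (begin
    p ⊛ (f ⊛ g) ⊕ f   ≈⟨ solve 3 (λ f g p → p :* (f :* g) :+ f := f :* (con 1 :+ p :* g)) ≈-refl f g p ⟩
    f ⊛ (𝟙 ⊕ p ⊛ g)   ≈⟨ ⊛≈-cong ≈-refl (geo-unfold s) ⟨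
    f ⊛ g             ≈⟨ ⊛≈-cong f-unfold ≈-refl ⟩
    (𝟙 ⊕ p ⊛ f) ⊛ g   ≈⟨ solve 3 (λ f g p → (con 1 :+ p :* f) :* g := p :* (f :* g) :+ g) ≈-refl f g p ⟩
    p ⊛ (f ⊛ g) ⊕ g   ∎)
    where
    p = X (suc s)
    g = geo (suc s)

  -- Multiplication by 1 - p, written without subtraction: f g = p f g + f.
  geo-cancelʳ : ∀ {s f h} → f ⊛ geo (suc s) ≈ h ⊛ geo (suc s) → f ≈ h
  geo-cancelʳ {s} {f} {h} fg≈hg = ⊕-cancelˡ {h = p ⊛ (f ⊛ g)} (begin
    p ⊛ (f ⊛ g) ⊕ f   ≈⟨ expand f ⟨
    f ⊛ g             ≈⟨ fg≈hg ⟩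
    h ⊛ g             ≈⟨ expand h ⟩
    p ⊛ (h ⊛ g) ⊕ h   ≈⟨ ⊕-cong (⊛≈-cong ≈-refl fg≈hg) ≈-refl ⟨
    p ⊛ (f ⊛ g) ⊕ h   ∎)
    where
    p = X (suc s)
    g = geo (suc s)
    expand : ∀ f → f ⊛ g ≈ p ⊛ (f ⊛ g) ⊕ f
    expand f = begin
      f ⊛ g             ≈⟨ ⊛≈-cong ≈-refl (geo-unfold s) ⟩
      f ⊛ (𝟙 ⊕ p ⊛ g)   ≈⟨ solve 3 (λ f g p → f :* (con 1 :+ p :* g) := p :* (f :* g) :+ f) ≈-refl f g p ⟩
      p ⊛ (f ⊛ g) ⊕ f   ∎

  geo-double : ∀ s → (𝟙 ⊕ X (suc s)) ⊛ geo (double (suc s)) ≈ geo (suc s)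
  geo-double s = geo-unique (begin
    (𝟙 ⊕ p) ⊛ g
      ≈⟨ solve 2 (λ p g → (con 1 :+ p) :* g := g :+ p :* g) ≈-refl p g ⟩
    g ⊕ p ⊛ g
      ≈⟨ ⊕-cong (geo-unfold (suc (double s))) ≈-refl ⟩
    𝟙 ⊕ X (double (suc s)) ⊛ g ⊕ p ⊛ g
      ≈⟨ ⊕-cong (⊕-cong {𝟙} ≈-refl (⊛≈-cong {X (double (suc s))} {p ⊛ p} {g} (X-double (suc s)) ≈-refl)) ≈-refl ⟩
    𝟙 ⊕ p ⊛ p ⊛ g ⊕ p ⊛ g
      ≈⟨ solve 2 (λ p g → con 1 :+ p :* p :* g :+ p :* g := con 1 :+ p :* ((con 1 :+ p) :* g)) ≈-refl p g ⟩
    𝟙 ⊕ p ⊛ ((𝟙 ⊕ p) ⊛ g) ∎)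
    where
    p = X (suc s)
    g = geo (double (suc s))

  geo-1 : (𝟙 ⊕ X 1) ⊛ (𝟙 ⊕ X 2) ⊛ geo 4 ≈ geo 1
  geo-1 = begin
    (𝟙 ⊕ X 1) ⊛ (𝟙 ⊕ X 2) ⊛ geo 4   ≈⟨ CommutativeSemiring.*-assoc series _ _ _ ⟩
    (𝟙 ⊕ X 1) ⊛ ((𝟙 ⊕ X 2) ⊛ geo 4) ≈⟨ ⊛≈-cong ≈-refl (geo-double 1) ⟩
    (𝟙 ⊕ X 1) ⊛ geo 2               ≈⟨ geo-double 0 ⟩
    geo 1                           ∎

  oddProduct : ℕ → Series
  oddProduct zero    = 𝟙
  oddProduct (suc k) = oddProduct k ⊛ geo (suc (double k))

  odd≥3Product : ℕ → Series
  odd≥3Product zero    = 𝟙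
  odd≥3Product (suc k) = odd≥3Product k ⊛ geo (3 + double k)

  oddProduct-suc : ∀ k → oddProduct (suc k) ≈ geo 1 ⊛ odd≥3Product k
  oddProduct-suc zero    = CommutativeSemiring.*-comm series 𝟙 (geo 1)
  oddProduct-suc (suc k) = begin
    oddProduct (suc k) ⊛ geo (3 + double k)         ≈⟨ ⊛≈-cong (oddProduct-suc k) ≈-refl ⟩
    geo 1 ⊛ odd≥3Product k ⊛ geo (3 + double k)     ≈⟨ CommutativeSemiring.*-assoc series _ _ _ ⟩
    geo 1 ⊛ (odd≥3Product k ⊛ geo (3 + double k))   ∎

  -- The product of geo (2i) for m < i ≤ m + n.
  evenProduct : ℕ → ℕ → Series
  evenProduct m zero    = 𝟙
  evenProduct m (suc n) = evenProduct m n ⊛ geo (double (suc (m + n)))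

  evenProduct-suc : ∀ m n → evenProduct m (suc n) ≈ evenProduct (suc m) n ⊛ geo (double (suc m))
  evenProduct-suc m zero rewrite +-identityʳ m = ≈-refl
  evenProduct-suc m (suc n) rewrite +-suc m n = begin
    evenProduct m (suc n) ⊛ g
      ≈⟨ ⊛≈-cong (evenProduct-suc m n) ≈-refl ⟩
    evenProduct (suc m) n ⊛ geo (double (suc m)) ⊛ g
      ≈⟨ solve 3 (λ e a g → e :* a :* g := e :* g :* a) ≈-refl (evenProduct (suc m) n) (geo (double (suc m))) g ⟩
    evenProduct (suc m) n ⊛ g ⊛ geo (double (suc m)) ∎
    where g = geo (double (suc (suc (m + n))))

  m+m≡double : ∀ m → m + m ≡ double m
  m+m≡double zero    = refl
  m+m≡double (suc m) = cong suc (trans (+-suc m m) (cong suc (m+m≡double m)))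

  -- (1 + q^i) geo (2i) = geo i for every i, and the even factors geo (2i) with
  -- 2i ≤ 2(k + 1) cancel except for geo 4, as ρ starts at i = 3.
  glaisher : ∀ k → ρ (double k) ⊛ evenProduct (1 + k) (1 + k) ≈ geo 4 ⊛ odd≥3Product k
  glaisher zero    = solve 1 (λ g → con 1 :* (con 1 :* g) := g :* con 1) ≈-refl (geo 4)
  -- The range k + 1 < i ≤ 2k + 2 of the even factors moves to k + 2 < i ≤ 2k + 4. It loses i = k +
  -- 2, whose factor is `g`, so `g` is multiplied in and cancelled; on the other side the same `g`
  -- arises from (1 + q^(2k+4)) geo (4k + 8).
  glaisher (suc k) = geo-cancelʳ (begin
    ρ (2 + d) ⊛ evenProduct (2 + k) (2 + k) ⊛ g
      ≈⟨ CommutativeSemiring.*-assoc series _ _ _ ⟩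
    ρ (2 + d) ⊛ (evenProduct (2 + k) (2 + k) ⊛ g)
      ≈⟨ ⊛≈-cong ≈-refl (evenProduct-suc (1 + k) (2 + k)) ⟨
    ρ (2 + d) ⊛ evenProduct (1 + k) (3 + k)
      ≈⟨ ⊛≈-cong ≈-refl (CommutativeSemiring.reflexive series last-two) ⟩
    ρ d ⊛ (𝟙 ⊕ X (3 + d)) ⊛ (𝟙 ⊕ X (4 + d))
      ⊛ (evenProduct (1 + k) (1 + k) ⊛ geo (double (3 + d)) ⊛ geo (double (4 + d)))
      ≈⟨ solve 6 (λ r a b e g h → r :* a :* b :* (e :* g :* h) := r :* e :* (a :* g) :* (b :* h))
           ≈-refl (ρ d) (𝟙 ⊕ X (3 + d)) (𝟙 ⊕ X (4 + d)) (evenProduct (1 + k) (1 + k))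
           (geo (double (3 + d))) (geo (double (4 + d))) ⟩
    ρ d ⊛ evenProduct (1 + k) (1 + k) ⊛ ((𝟙 ⊕ X (3 + d)) ⊛ geo (double (3 + d)))
      ⊛ ((𝟙 ⊕ X (4 + d)) ⊛ geo (double (4 + d)))
      ≈⟨ ⊛≈-cong (⊛≈-cong (glaisher k) (geo-double (2 + d))) (geo-double (3 + d)) ⟩
    geo 4 ⊛ odd≥3Product k ⊛ geo (3 + d) ⊛ g
      ≈⟨ ⊛≈-cong (CommutativeSemiring.*-assoc series _ _ _) ≈-refl ⟩
    geo 4 ⊛ odd≥3Product (1 + k) ⊛ g ∎)
    where
    d = double k
    g = geo (4 + d)
    last-two : evenProduct (1 + k) (3 + k) ≡
               evenProduct (1 + k) (1 + k) ⊛ geo (double (3 + d)) ⊛ geo (double (4 + d))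
    last-two rewrite +-suc k (suc k) | +-suc k k | m+m≡double k = refl

-- Comparison of the two sides, coefficientwise up to a fixed degree.

-- For partitions into the parts 1, 3, …, 2k - 1, the series that counts each of
-- them once per hook of length two (once per pair of such hooks) is
-- oddProduct k times e₁ k (e₂ k); y k is the share of the part 2k + 1.
y z e₁ e₂ : ℕ → Series
y zero    = X 2
y (suc k) = X (3 + double k) ⊕ X (double (3 + double k))
z zero    = 𝟘
z (suc k) = X (double (3 + double k))
e₁ zero    = 𝟘
e₁ (suc k) = e₁ k ⊕ y k
e₂ zero    = 𝟘
e₂ (suc k) = e₂ k ⊕ (y k ⊛ e₁ k ⊕ z k)

-- Degree n of a product involves only degrees up to n of its factors, so truncated inequalities can
-- be multiplied.
⊛-mono-coeff : ∀ {f f′ g g′ : Series} n → (∀ i → i ≤ n → f i ≤ f′ i) → (∀ i → i ≤ n → g i ≤ g′ i) →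
               (f ⊛ g) n ≤ (f′ ⊛ g′) n
⊛-mono-coeff zero    p r = *-mono-≤ (p 0 z≤n) (r 0 z≤n)
⊛-mono-coeff (suc n) p r = +-mono-≤ (*-mono-≤ (p 0 z≤n) (r (suc n) ≤-refl))
  (⊛-mono-coeff n (λ i i≤n → p (suc i) (s≤s i≤n)) (λ i i≤n → r i (m≤n⇒m≤1+n i≤n)))

-- Inequalities between series up to the degree N, which is fixed throughout.
module Truncated (N : ℕ) where

  infix 4 _≼_
  record _≼_ (f g : Series) : Set where
    constructor coeffwise-≤
    field coeff-≤ : ∀ n → n ≤ N → f n ≤ g n

  open _≼_ public

  ≼-preorder : Preorder 0ℓ 0ℓ 0ℓ
  ≼-preorder = record
    { _≈_ = _≈_ ; _≲_ = _≼_
    ; isPreorder = record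
      { isEquivalence = CommutativeSemiring.isEquivalence series
      ; reflexive = λ p → coeffwise-≤ λ n _ → ≤-reflexive (coeff p n)
      ; trans     = λ p r → coeffwise-≤ λ n n≤N → ≤-trans (coeff-≤ p n n≤N) (coeff-≤ r n n≤N) } }

  open Preorder ≼-preorder public using () renaming (refl to ≼-refl; trans to ≼-trans)
  open PreorderReasoning ≼-preorder

  ⊕-mono : ∀ {f f′ g g′} → f ≼ f′ → g ≼ g′ → f ⊕ g ≼ f′ ⊕ g′
  ⊕-mono p r = coeffwise-≤ λ n n≤N → +-mono-≤ (coeff-≤ p n n≤N) (coeff-≤ r n n≤N)

  ⊛-mono : ∀ {f f′ g g′} → f ≼ f′ → g ≼ g′ → f ⊛ g ≼ f′ ⊛ g′
  ⊛-mono p r = coeffwise-≤ λ n n≤N → ⊛-mono-coeff n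
    (λ i i≤n → coeff-≤ p i (≤-trans i≤n n≤N)) (λ i i≤n → coeff-≤ r i (≤-trans i≤n n≤N))

  f≼f⊕g : ∀ f g → f ≼ f ⊕ g
  f≼f⊕g f g = coeffwise-≤ λ n _ → m≤m+n (f n) (g n)

  f≼f⊛g : ∀ f {g} → 𝟙 ≼ g → f ≼ f ⊛ g
  f≼f⊛g f {g} 𝟙≼g = begin
    f     ≈⟨ CommutativeSemiring.*-identityʳ series f ⟨
    f ⊛ 𝟙 ≲⟨ ⊛-mono ≼-refl 𝟙≼g ⟩
    f ⊛ g ∎

  𝟙≼geo : ∀ s → 𝟙 ≼ geo (suc s)
  𝟙≼geo s = begin
    𝟙                             ≲⟨ f≼f⊕g 𝟙 _ ⟩
    𝟙 ⊕ X (suc s) ⊛ geo (suc s)   ≈⟨ geo-unfold s ⟨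
    geo (suc s)                   ∎

  𝟙≼evenProduct : ∀ m n → 𝟙 ≼ evenProduct m n
  𝟙≼evenProduct m zero    = ≼-refl
  𝟙≼evenProduct m (suc n) = ≼-trans (𝟙≼evenProduct m n) (f≼f⊛g _ (𝟙≼geo _))

  ρ≼ : ∀ k → ρ (double k) ≼ geo 4 ⊛ odd≥3Product k
  ρ≼ k = begin
    ρ (double k)                               ≲⟨ f≼f⊛g _ (𝟙≼evenProduct (1 + k) (1 + k)) ⟩
    ρ (double k) ⊛ evenProduct (1 + k) (1 + k) ≈⟨ glaisher k ⟩
    geo 4 ⊛ odd≥3Product k                     ∎

  private
    c : Series
    c = (𝟙 ⊕ X 1) ⊛ (𝟙 ⊕ X 2)

  -- The extra summands on the left are what makes the induction work.
  bracket≼e₁ : ∀ k → let p = X (double k) in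
    X 2 ⊛ (𝟙 ⊕ X 1) ⊛ bracket (2 + double k) ⊕ (X 5 ⊕ p ⊛ (X 4 ⊕ X 5 ⊕ X 6)) ≼ c ⊛ e₁ (2 + k)
  bracket≼e₁ zero = begin
    X 2 ⊛ (𝟙 ⊕ X 1) ⊛ bracket 2 ⊕ (X 5 ⊕ 𝟙 ⊛ (X 4 ⊕ X 5 ⊕ X 6))
      -- With the extra summands the left side is exactly `c` times q^2 + q^3; the added `c ⊛ X 6`
      -- is the share of a repeated 3 in `y 1`.
      ≲⟨ f≼f⊕g _ _ ⟩
    X 2 ⊛ (𝟙 ⊕ X 1) ⊛ bracket 2 ⊕ (X 5 ⊕ 𝟙 ⊛ (X 4 ⊕ X 5 ⊕ X 6)) ⊕ c ⊛ X 6
      ≈⟨ solve 1 (λ q →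
           (2 ▹ con 1) q :* (con 1 :+ (1 ▹ con 1) q) :* (con 0 :+ con 1 :+ (1 ▹ con 1) q)
             :+ ((5 ▹ con 1) q :+ con 1 :* ((4 ▹ con 1) q :+ (5 ▹ con 1) q :+ (6 ▹ con 1) q))
             :+ (con 1 :+ (1 ▹ con 1) q) :* (con 1 :+ (2 ▹ con 1) q) :* (6 ▹ con 1) q :=
           (con 1 :+ (1 ▹ con 1) q) :* (con 1 :+ (2 ▹ con 1) q) :*
             (con 0 :+ (2 ▹ con 1) q :+ ((3 ▹ con 1) q :+ (6 ▹ con 1) q))) ≈-refl q ⟩
    c ⊛ e₁ 2 ∎
  bracket≼e₁ (suc k) = begin
    X 2 ⊛ (𝟙 ⊕ X 1) ⊛ (b ⊕ X (2 + d) ⊕ X (3 + d)) ⊕ (X 5 ⊕ X (2 + d) ⊛ (X 4 ⊕ X 5 ⊕ X 6))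
      -- The extra summands are chosen to make the increment exactly c q^(d+5): the q-integer
      -- contributes q^(d+4) (1 + q)^2, and the extra part changes by q^d (q^2 - 1)(q^4 + q^5 +
      -- q^6).
      ≈⟨ solve 3 (λ q b p →
           (2 ▹ con 1) q :* (con 1 :+ (1 ▹ con 1) q) :* (b :+ (2 ▹ p) q :+ (3 ▹ p) q)
             :+ ((5 ▹ con 1) q :+ (2 ▹ p) q :* ((4 ▹ con 1) q :+ (5 ▹ con 1) q :+ (6 ▹ con 1) q)) :=
           (2 ▹ con 1) q :* (con 1 :+ (1 ▹ con 1) q) :* b
             :+ ((5 ▹ con 1) q :+ p :* ((4 ▹ con 1) q :+ (5 ▹ con 1) q :+ (6 ▹ con 1) q))
             :+ (con 1 :+ (1 ▹ con 1) q) :* (con 1 :+ (2 ▹ con 1) q) :* (5 ▹ p) q) ≈-refl q b (X d) ⟩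
    X 2 ⊛ (𝟙 ⊕ X 1) ⊛ b ⊕ (X 5 ⊕ X d ⊛ (X 4 ⊕ X 5 ⊕ X 6)) ⊕ c ⊛ X (5 + d)
      ≲⟨ ⊕-mono (bracket≼e₁ k) (f≼f⊕g _ _) ⟩
    c ⊛ e₁ (2 + k) ⊕ (c ⊛ X (5 + d) ⊕ c ⊛ X (double (5 + d)))
      ≈⟨ solve 4 (λ c e p r → c :* e :+ (c :* p :+ c :* r) := c :* (e :+ (p :+ r)))
           ≈-refl c (e₁ (2 + k)) (X (5 + d)) (X (double (5 + d))) ⟩
    c ⊛ e₁ (3 + k) ∎
    where
    d = double k
    b = bracket (2 + d)

  binom₂≼e₂ : ∀ k → X 6 ⊛ binom₂ (double k) ≼ c ⊛ e₂ (2 + k)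
  binom₂≼e₂ zero = begin
    X 6 ⊛ 𝟙
      -- The single term q^6 is matched by `z 1`, the two hooks of a repeated part 3.
      ≲⟨ f≼f⊕g _ (X 6 ⊛ (X 1 ⊕ X 2 ⊕ X 3) ⊕ c ⊛ (y 1 ⊛ X 2)) ⟩
    X 6 ⊛ 𝟙 ⊕ (X 6 ⊛ (X 1 ⊕ X 2 ⊕ X 3) ⊕ c ⊛ (y 1 ⊛ X 2))
      ≈⟨ solve 2 (λ q y → (6 ▹ con 1) q :* con 1
             :+ ((6 ▹ con 1) q :* ((1 ▹ con 1) q :+ (2 ▹ con 1) q :+ (3 ▹ con 1) q)
             :+ (con 1 :+ (1 ▹ con 1) q) :* (con 1 :+ (2 ▹ con 1) q) :* (y :* (2 ▹ con 1) q)) :=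
           (con 1 :+ (1 ▹ con 1) q) :* (con 1 :+ (2 ▹ con 1) q) :*
             (con 0 :+ ((2 ▹ con 1) q :* con 0 :+ con 0)
               :+ (y :* (con 0 :+ (2 ▹ con 1) q) :+ (6 ▹ con 1) q))) ≈-refl q (y 1) ⟩
    c ⊛ e₂ 2 ∎
  binom₂≼e₂ (suc k) = begin
    X 6 ⊛ (B ⊕ X (1 + d) ⊛ b ⊕ X (2 + d) ⊛ (b ⊕ X (2 + d)))
      ≈⟨ solve 4 (λ q B b p →
           (6 ▹ con 1) q :* (B :+ (1 ▹ p) q :* b :+ (2 ▹ p) q :* (b :+ (2 ▹ p) q)) :=
           (6 ▹ con 1) q :* B :+ ((5 ▹ p) q :* ((2 ▹ con 1) q :* (con 1 :+ (1 ▹ con 1) q) :* b)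
             :+ (5 ▹ p) q :* (5 ▹ p) q)) ≈-refl q B b (X d) ⟩
    X 6 ⊛ B ⊕ (p ⊛ (X 2 ⊛ (𝟙 ⊕ X 1) ⊛ b) ⊕ p ⊛ p)
      ≲⟨ ⊕-mono (binom₂≼e₂ k) (⊕-mono
           (⊛-mono ≼-refl (≼-trans (f≼f⊕g _ _) (bracket≼e₁ k)))
           (Preorder.reflexive ≼-preorder (≈-sym (X-double (5 + d))))) ⟩
    c ⊛ e₂ (2 + k) ⊕ (p ⊛ (c ⊛ e₁ (2 + k)) ⊕ p²)
      -- The surplus on the right: the summand `p²` of `y (2 + k)`, and `c` minus 1 times
      -- `z (2 + k)`.
      ≲⟨ f≼f⊕g _ (p² ⊛ (c ⊛ e₁ (2 + k)) ⊕ (X 1 ⊕ X 2 ⊕ X 3) ⊛ p²) ⟩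
    c ⊛ e₂ (2 + k) ⊕ (p ⊛ (c ⊛ e₁ (2 + k)) ⊕ p²) ⊕ (p² ⊛ (c ⊛ e₁ (2 + k)) ⊕ (X 1 ⊕ X 2 ⊕ X 3) ⊛ p²)
      ≈⟨ solve 5 (λ q e f p r → let c = (con 1 :+ (1 ▹ con 1) q) :* (con 1 :+ (2 ▹ con 1) q) in
           c :* f :+ (p :* (c :* e) :+ r)
             :+ (r :* (c :* e) :+ ((1 ▹ con 1) q :+ (2 ▹ con 1) q :+ (3 ▹ con 1) q) :* r) :=
           c :* (f :+ ((p :+ r) :* e :+ r))) ≈-refl q (e₁ (2 + k)) (e₂ (2 + k)) p p² ⟩
    c ⊛ e₂ (3 + k) ∎
    where
    d = double k
    B = binom₂ d
    b = bracket (2 + d)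
    p = X (5 + d)
    p² = X (double (5 + d))

  D₂≼ : ∀ k → D₂ (double (suc k)) ≼ oddProduct (suc k) ⊛ e₂ (suc k)
  -- Partitions into distinct parts at most 2 have at most one hook of length two, hence no pair.
  D₂≼ zero = begin
    (𝟙 ⊕ X 2) ⊛ 𝟘 ⊕ X 2 ⊛ 𝟘    ≈⟨ solve 1 (λ p → (con 1 :+ p) :* con 0 :+ p :* con 0 := con 0) ≈-refl (X 2) ⟩
    𝟘                         ≲⟨ f≼f⊕g 𝟘 _ ⟩
    oddProduct 1 ⊛ e₂ 1       ∎
  D₂≼ (suc k) = begin
    D₂ (4 + double k)
      ≈⟨ D₂-closed (double k) ⟩
    X 6 ⊛ binom₂ (double k) ⊛ ρ (double k)
      ≲⟨ ⊛-mono (binom₂≼e₂ k) (ρ≼ k) ⟩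
    c ⊛ e₂ (2 + k) ⊛ (geo 4 ⊛ odd≥3Product k)
      ≈⟨ solve 4 (λ c e g o → c :* e :* (g :* o) := c :* g :* o :* e) ≈-refl c (e₂ (2 + k)) (geo 4) (odd≥3Product k) ⟩
    c ⊛ geo 4 ⊛ odd≥3Product k ⊛ e₂ (2 + k)
      ≈⟨ ⊛≈-cong (⊛≈-cong geo-1 ≈-refl) ≈-refl ⟩
    geo 1 ⊛ odd≥3Product k ⊛ e₂ (2 + k)
      ≈⟨ ⊛≈-cong (oddProduct-suc k) ≈-refl ⟨
    oddProduct (1 + k) ⊛ e₂ (2 + k)
      -- Glaisher's identity supplies odd parts only up to 2k + 1; the factor for 2k + 3 has
      -- constant term 1 and can only enlarge the right side.
      ≲⟨ ⊛-mono (f≼f⊛g _ (𝟙≼geo _)) ≼-refl ⟩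
    oddProduct (2 + k) ⊛ e₂ (2 + k) ∎

-- Scalar multiples and finite sums of series.

·-⊛-interchange : ∀ a b f g → (a * b) · (f ⊛ g) ≈ (a · f) ⊛ (b · g)
·-⊛-interchange a b f g = coeffwise λ n → begin
  a * b * (f ⊛ g) n        ≡⟨ *-assoc a b _ ⟩
  a * (b * (f ⊛ g) n)      ≡⟨ cong (λ e → a * (b * e)) (⊛-comm f g n) ⟩
  a * (b * (g ⊛ f) n)      ≡⟨ cong (a *_) (·-⊛ b g f n) ⟨
  a * ((b · g) ⊛ f) n      ≡⟨ cong (a *_) (⊛-comm (b · g) f n) ⟩
  a * (f ⊛ (b · g)) n      ≡⟨ ·-⊛ a f (b · g) n ⟨
  ((a · f) ⊛ (b · g)) n    ∎
  where open ≡-Reasoning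

·-congˡ : ∀ {a b} f → a ≡ b → a · f ≈ b · f
·-congˡ f refl = ≈-refl

·-congʳ : ∀ a {f g} → f ≈ g → a · f ≈ a · g
·-congʳ a p = coeffwise λ n → cong (a *_) (coeff p n)

·-distrib-+ : ∀ a b f → (a + b) · f ≈ a · f ⊕ b · f
·-distrib-+ a b f = coeffwise λ n → *-distribʳ-+ (f n) a b

·-identity : ∀ f → 1 · f ≈ f
·-identity f = coeffwise λ n → *-identityˡ (f n)

sumₛ : ∀ {A : Set} → (A → Series) → List A → Series
sumₛ φ []       = 𝟘
sumₛ φ (a ∷ as) = φ a ⊕ sumₛ φ as

module _ {A : Set} where

  sumₛ-coeff : ∀ (φ : A → Series) as n → sumₛ φ as n ≡ sum (map (λ a → φ a n) as)
  sumₛ-coeff φ []       n = refl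
  sumₛ-coeff φ (a ∷ as) n = cong (φ a n +_) (sumₛ-coeff φ as n)

  sumₛ-cong-∈ : ∀ {φ ψ : A → Series} as → (∀ {a} → a ∈ as → φ a ≈ ψ a) → sumₛ φ as ≈ sumₛ ψ as
  sumₛ-cong-∈ []       p = ≈-refl
  sumₛ-cong-∈ (a ∷ as) p = ⊕-cong (p (here refl)) (sumₛ-cong-∈ as (p ∘ there))

  sumₛ-cong : ∀ {φ ψ : A → Series} as → (∀ a → φ a ≈ ψ a) → sumₛ φ as ≈ sumₛ ψ as
  sumₛ-cong as p = sumₛ-cong-∈ as (λ {a} _ → p a)

  open ≈-Reasoning

  sumₛ-++ : ∀ (φ : A → Series) as bs → sumₛ φ (as ++ bs) ≈ sumₛ φ as ⊕ sumₛ φ bs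
  sumₛ-++ φ []       bs = ≈-refl
  sumₛ-++ φ (a ∷ as) bs = begin
    φ a ⊕ sumₛ φ (as ++ bs)           ≈⟨ ⊕-cong {φ a} ≈-refl (sumₛ-++ φ as bs) ⟩
    φ a ⊕ (sumₛ φ as ⊕ sumₛ φ bs)     ≈⟨ CommutativeSemiring.+-assoc series (φ a) _ _ ⟨
    φ a ⊕ sumₛ φ as ⊕ sumₛ φ bs       ∎

  sumₛ-⊕ : ∀ (φ ψ : A → Series) as → sumₛ (λ a → φ a ⊕ ψ a) as ≈ sumₛ φ as ⊕ sumₛ ψ as
  sumₛ-⊕ φ ψ []       = ≈-refl
  sumₛ-⊕ φ ψ (a ∷ as) = begin
    φ a ⊕ ψ a ⊕ sumₛ (λ a → φ a ⊕ ψ a) as     ≈⟨ ⊕-cong {φ a ⊕ ψ a} ≈-refl (sumₛ-⊕ φ ψ as) ⟩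
    φ a ⊕ ψ a ⊕ (sumₛ φ as ⊕ sumₛ ψ as)       ≈⟨ solve 4 (λ a b c d → a :+ b :+ (c :+ d) := a :+ c :+ (b :+ d))
                                                   ≈-refl (φ a) (ψ a) (sumₛ φ as) (sumₛ ψ as) ⟩
    φ a ⊕ sumₛ φ as ⊕ (ψ a ⊕ sumₛ ψ as)       ∎

  sumₛ-⊛ʳ : ∀ (φ : A → Series) f as → sumₛ (λ a → φ a ⊛ f) as ≈ sumₛ φ as ⊛ f
  sumₛ-⊛ʳ φ f []       = ≈-sym (CommutativeSemiring.zeroˡ series f)
  sumₛ-⊛ʳ φ f (a ∷ as) = begin
    φ a ⊛ f ⊕ sumₛ (λ a → φ a ⊛ f) as     ≈⟨ ⊕-cong {φ a ⊛ f} ≈-refl (sumₛ-⊛ʳ φ f as) ⟩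
    φ a ⊛ f ⊕ sumₛ φ as ⊛ f               ≈⟨ CommutativeSemiring.distribʳ series f (φ a) _ ⟨
    (φ a ⊕ sumₛ φ as) ⊛ f                 ∎

  sumₛ-⊛ˡ : ∀ (φ : A → Series) f as → sumₛ (λ a → f ⊛ φ a) as ≈ f ⊛ sumₛ φ as
  sumₛ-⊛ˡ φ f as = begin
    sumₛ (λ a → f ⊛ φ a) as   ≈⟨ sumₛ-cong as (λ a → CommutativeSemiring.*-comm series f (φ a)) ⟩
    sumₛ (λ a → φ a ⊛ f) as   ≈⟨ sumₛ-⊛ʳ φ f as ⟩
    sumₛ φ as ⊛ f             ≈⟨ CommutativeSemiring.*-comm series _ f ⟩
    f ⊛ sumₛ φ as             ∎

  sumₛ-map : ∀ {B : Set} (φ : B → Series) (h : A → B) as → sumₛ φ (map h as) ≈ sumₛ (φ ∘ h) as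
  sumₛ-map φ h []       = ≈-refl
  sumₛ-map φ h (a ∷ as) = ⊕-cong {φ (h a)} ≈-refl (sumₛ-map φ h as)

sumₛ-cartesianProductWith : ∀ {A B C : Set} (φ : C → Series) (h : A → B → C) as bs →
  sumₛ φ (cartesianProductWith h as bs) ≈ sumₛ (λ a → sumₛ (φ ∘ h a) bs) as
sumₛ-cartesianProductWith φ h []       bs = ≈-refl
sumₛ-cartesianProductWith φ h (a ∷ as) bs = ≈-trans
  (sumₛ-++ φ (map (h a) bs) _)
  (⊕-cong (sumₛ-map φ (h a) bs) (sumₛ-cartesianProductWith φ h as bs))

-- Hooks of length two in the first row of a diagram.

rowHooks₂ : ℕ → List ℕ → ℕ
rowHooks₂ r μs = length (filter (_≟ 2) (map (hookLength r μs) (upTo r)))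

hooks₂-∷ : ∀ r μs → hooks₂ (r ∷ μs) ≡ rowHooks₂ r μs + hooks₂ μs
hooks₂-∷ r μs = trans
  (cong length (filter-++ (_≟ 2) (map (hookLength r μs) (upTo r)) (hookLengths μs)))
  (length-++ (filter (_≟ 2) (map (hookLength r μs) (upTo r))))

-- Only the last two cells of a row have arm less than 2, so columns are peeled off from the right
-- end.
module Columns (f : ℕ → ℕ) where

  twos : ℕ → ℕ
  twos r = length (filter (_≟ 2) (map f (upTo r)))

  twos-suc : ∀ r → twos (suc r) ≡ twos r + length (filter (_≟ 2) (f r ∷ []))
  twos-suc r = begin
    twos (suc r)
      ≡⟨ cong (length ∘ filter (_≟ 2) ∘ map f) (upTo-∷ʳ r) ⟨
    length (filter (_≟ 2) (map f (upTo r ++ r ∷ [])))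
      ≡⟨ cong (length ∘ filter (_≟ 2)) (map-++ f (upTo r) (r ∷ [])) ⟩
    length (filter (_≟ 2) (map f (upTo r) ++ f r ∷ []))
      ≡⟨ cong length (filter-++ (_≟ 2) (map f (upTo r)) (f r ∷ [])) ⟩
    length (filter (_≟ 2) (map f (upTo r)) ++ filter (_≟ 2) (f r ∷ []))
      ≡⟨ length-++ (filter (_≟ 2) (map f (upTo r))) ⟩
    twos r + length (filter (_≟ 2) (f r ∷ [])) ∎
    where open ≡-Reasoning

  twos-yes : ∀ r → f r ≡ 2 → twos (suc r) ≡ suc (twos r)
  twos-yes r p = trans (twos-suc r)
    (trans (cong (λ l → twos r + length l) (filter-accept (_≟ 2) p)) (+-comm (twos r) 1))

  twos-no : ∀ r → f r ≢ 2 → twos (suc r) ≡ twos r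
  twos-no r p = trans (twos-suc r)
    (trans (cong (λ l → twos r + length l) (filter-reject (_≟ 2) p)) (+-identityʳ (twos r)))

  twos-one : ∀ r → f r ≡ 1 → twos (suc r) ≡ twos r
  twos-one r p = twos-no r (λ f≡2 → <⇒≢ ≤-refl (trans (sym p) f≡2))

  twos-none : ∀ r → (∀ {j} → j < r → f j ≢ 2) → twos r ≡ 0
  twos-none r p = cong length (filter-none (_≟ 2) (All.map⁺ (All.tabulate (p ∘ ∈-upTo⁻))))

leg-none : ∀ {μs j} → All (_≤ j) μs → leg μs j ≡ 0
leg-none p = cong length (filter-none _ (All.map ≤⇒≯ p))

leg-∷ : ∀ r μs j → j < r → leg (r ∷ μs) j ≡ suc (leg μs j)
leg-∷ r μs j j<r = cong length (filter-accept (j <?_) {xs = μs} j<r)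

arm-≥ : ∀ {r j} k → k + j < r → k ≤ arm r j
arm-≥ {r} {j} k p = m+n≤o⇒m≤o∸n k (subst (_≤ r) (sym (+-suc k j)) p)

2≤m⇒1+m≢2 : ∀ {m} → 2 ≤ m → suc m ≢ 2
2≤m⇒1+m≢2 2≤m p = <⇒≢ 2≤m (sym (suc-injective p))

-- Columns from `r` on miss `μs`, so legs there count only the row of length `1 + r`, if present. A
-- hook of length two then has arm 1 and leg 0 (a gap below) or arm 0 and leg 1 (a repeated part); a
-- row one shorter below turns the former into length three.
module _ {r : ℕ} {μs : List ℕ} (μs≤r : All (_≤ r) μs) where

  rowHooks₂-gap : rowHooks₂ (2 + r) μs ≡ 1
  rowHooks₂-gap = begin
    twos (2 + r)   ≡⟨ twos-one (1 + r) last-column ⟩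
    twos (1 + r)   ≡⟨ twos-yes r (cong₂ (λ a l → 1 + a + l) (m+n∸n≡m 1 r) (leg-none μs≤r)) ⟩
    suc (twos r)   ≡⟨ cong suc (twos-none r λ {j} j<r → 2≤m⇒1+m≢2 (m≤n⇒m≤n+o _ (arm-≥ 2 (s≤s (s≤s j<r))))) ⟩
    1              ∎
    where
    open ≡-Reasoning
    open Columns (hookLength (2 + r) μs)
    last-column : hookLength (2 + r) μs (1 + r) ≡ 1
    last-column = cong₂ (λ a l → 1 + a + l) (n∸n≡0 r) (leg-none (All.map m≤n⇒m≤1+n μs≤r))

  rowHooks₂-consecutive : rowHooks₂ (2 + r) (1 + r ∷ μs) ≡ 0
  rowHooks₂-consecutive = begin
    twos (2 + r)   ≡⟨ twos-one (1 + r) last-column ⟩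
    twos (1 + r)   ≡⟨ twos-none (1 + r) (λ {j} j≤r → 2≤m⇒1+m≢2 (+-mono-≤ (arm-≥ 1 (s≤s j≤r))
                        (subst (1 ≤_) (sym (leg-∷ (1 + r) μs j j≤r)) (s≤s z≤n)))) ⟩
    0              ∎
    where
    open ≡-Reasoning
    open Columns (hookLength (2 + r) (1 + r ∷ μs))
    last-column : hookLength (2 + r) (1 + r ∷ μs) (1 + r) ≡ 1
    last-column = cong₂ (λ a l → 1 + a + l) (n∸n≡0 r) (leg-none (≤-refl ∷ All.map m≤n⇒m≤1+n μs≤r))

  rowHooks₂-repeat : rowHooks₂ (1 + r) (1 + r ∷ μs) ≡ 1
  rowHooks₂-repeat = begin
    twos (1 + r)   ≡⟨ twos-yes r (cong₂ (λ a l → 1 + a + l) (n∸n≡0 r)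
                        (trans (leg-∷ (1 + r) μs r ≤-refl) (cong suc (leg-none μs≤r)))) ⟩
    suc (twos r)   ≡⟨ cong suc (twos-none r λ {j} j<r → 2≤m⇒1+m≢2 (+-mono-≤ (arm-≥ 1 (s≤s j<r))
                        (subst (1 ≤_) (sym (leg-∷ (1 + r) μs j (m≤n⇒m≤1+n j<r))) (s≤s z≤n)))) ⟩
    1              ∎
    where
    open ≡-Reasoning
    open Columns (hookLength (1 + r) (1 + r ∷ μs))

-- Two equal rows below force every leg to be at least 2, so of all copies of a part only the lowest
-- two matter.
rowHooks₂-triple : ∀ r μs → rowHooks₂ r (r ∷ r ∷ μs) ≡ 0
rowHooks₂-triple r μs = twos-none r λ {j} j<r → 2≤m⇒1+m≢2 (m≤n⇒m≤o+n (arm r j)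
  (subst (2 ≤_) (sym (trans (leg-∷ r (r ∷ μs) j j<r) (cong suc (leg-∷ r μs j j<r)))) (s≤s (s≤s z≤n))))
  where open Columns (hookLength r (r ∷ r ∷ μs))

-- Weighted enumeration of partitions into distinct parts.

term : (ℕ → ℕ) → List ℕ → Series
term w λs = w (hooks₂ λs) · X (sum λs)

·-X-+ : ∀ a m n → a · X (m + n) ≈ X m ⊛ (a · X n)
·-X-+ a m n = begin
  a · X (m + n)             ≈⟨ ·-congʳ a (X-+ m n) ⟩
  a · (X m ⊛ X n)           ≈⟨ ·-congˡ (X m ⊛ X n) (*-identityˡ a) ⟨
  (1 * a) · (X m ⊛ X n)     ≈⟨ ·-⊛-interchange 1 a (X m) (X n) ⟩
  (1 · X m) ⊛ (a · X n)     ≈⟨ ⊛≈-cong (·-identity (X m)) ≈-refl ⟩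
  X m ⊛ (a · X n)           ∎
  where open ≈-Reasoning

distincts : ℕ → List (List ℕ)
distincts zero    = [] ∷ []
distincts (suc k) = distincts k ++ map (suc k ∷_) (distincts k)

distincts-≤ : ∀ k {λs} → λs ∈ distincts k → All (_≤ k) λs
distincts-≤ zero    (here refl) = []
distincts-≤ (suc k) λs∈ with ∈-++⁻ (distincts k) λs∈
... | inj₁ ∈k = All.map m≤n⇒m≤1+n (distincts-≤ k ∈k)
... | inj₂ ∈k with ∈-map⁻ (suc k ∷_) ∈k
...   | μs , ∈k′ , refl = ≤-refl ∷ All.map m≤n⇒m≤1+n (distincts-≤ k ∈k′)

distincts-complete : ∀ k {λs} → AllPairs _≥_ λs → Unique λs → All (0 <_) λs → All (_≤ k) λs →
                     λs ∈ distincts k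
distincts-complete zero    {[]}     _ _ _ _ = here refl
distincts-complete zero    {_ ∷ _}  _ _ (() ∷ _) (z≤n ∷ _)
distincts-complete (suc k) {[]}     _ _ _ _ = ∈-++⁺ˡ (distincts-complete k [] [] [] [])
distincts-complete (suc k) {r ∷ μs} (μs≤r ∷ sorted) (r∉μs ∷ uniq) (0<r ∷ pos) (r≤1+k ∷ bound)
  with r ≟ suc k
... | yes refl = ∈-++⁺ʳ (distincts k) (∈-map⁺ (suc k ∷_) (distincts-complete k sorted uniq pos
                   (All.zipWith (λ (μ≤r , r≢μ) → ≤-pred (≤∧≢⇒< μ≤r (≢-sym r≢μ))) (μs≤r , r∉μs))))
... | no  r≢   = ∈-++⁺ˡ (distincts-complete k (μs≤r ∷ sorted) (r∉μs ∷ uniq) (0<r ∷ pos)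
                   (r≤k ∷ All.map (λ μ≤r → ≤-trans μ≤r r≤k) μs≤r))
  where r≤k = ≤-pred (≤∧≢⇒< r≤1+k r≢)

distinctSum : (ℕ → ℕ) → ℕ → Series
distinctSum w k = sumₛ (term w) (distincts k)

module _ where
  open ≈-Reasoning

  distinctSum-suc : ∀ w k →
    distinctSum w (suc k) ≈ distinctSum w k ⊕ sumₛ (term w) (map (suc k ∷_) (distincts k))
  distinctSum-suc w k = sumₛ-++ (term w) (distincts k) (map (suc k ∷_) (distincts k))

  -- If the part k + 2 occurs, it adds a hook exactly when k + 1 does not. The added hook costs the
  -- difference `w′` of the weight, and the weights C(h, 2), h, 1, 0 are successive differences;
  -- this is the expansion in t - 1.
  distinctSum-rec : ∀ w w′ → (∀ h → w (suc h) ≡ w′ h + w h) → ∀ k →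
    distinctSum w (2 + k) ≈ (𝟙 ⊕ X (2 + k)) ⊛ distinctSum w (1 + k) ⊕ X (2 + k) ⊛ distinctSum w′ k
  distinctSum-rec w w′ w-suc k = begin
    distinctSum w (2 + k)
      ≈⟨ distinctSum-suc w (1 + k) ⟩
    distinctSum w (1 + k) ⊕ sumₛ (term w) (map (2 + k ∷_) (distincts (1 + k)))
      ≈⟨ ⊕-cong {distinctSum w (1 + k)} ≈-refl (begin
        sumₛ (term w) (map (2 + k ∷_) (distincts (1 + k)))
          ≈⟨ sumₛ-map (term w) (2 + k ∷_) (distincts (1 + k)) ⟩
        sumₛ (term w ∘ (2 + k ∷_)) (distincts (1 + k))
          ≈⟨ sumₛ-++ (term w ∘ (2 + k ∷_)) (distincts k) (map (1 + k ∷_) (distincts k)) ⟩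
        sumₛ (term w ∘ (2 + k ∷_)) (distincts k)
          ⊕ sumₛ (term w ∘ (2 + k ∷_)) (map (1 + k ∷_) (distincts k))
          ≈⟨ ⊕-cong without-1+k with-1+k ⟩
        X (2 + k) ⊛ (distinctSum w′ k ⊕ distinctSum w k) ⊕ X (2 + k) ⊛ u ∎) ⟩
    distinctSum w (1 + k) ⊕ (X (2 + k) ⊛ (distinctSum w′ k ⊕ distinctSum w k) ⊕ X (2 + k) ⊛ u)
      ≈⟨ solve 5 (λ s p s′ t u → s :+ (p :* (s′ :+ t) :+ p :* u) := s :+ p :* (t :+ u) :+ p :* s′)
           ≈-refl (distinctSum w (1 + k)) (X (2 + k)) (distinctSum w′ k) (distinctSum w k) u ⟩
    distinctSum w (1 + k) ⊕ X (2 + k) ⊛ (distinctSum w k ⊕ u) ⊕ X (2 + k) ⊛ distinctSum w′ k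
      ≈⟨ ⊕-cong (⊕-cong {distinctSum w (1 + k)} ≈-refl (⊛≈-cong ≈-refl (distinctSum-suc w k))) ≈-refl ⟨
    distinctSum w (1 + k) ⊕ X (2 + k) ⊛ distinctSum w (1 + k) ⊕ X (2 + k) ⊛ distinctSum w′ k
      ≈⟨ ⊕-cong (solve 2 (λ s p → s :+ p :* s := (con 1 :+ p) :* s) ≈-refl
           (distinctSum w (1 + k)) (X (2 + k))) ≈-refl ⟩
    (𝟙 ⊕ X (2 + k)) ⊛ distinctSum w (1 + k) ⊕ X (2 + k) ⊛ distinctSum w′ k ∎
    where
    u = sumₛ (term w) (map (1 + k ∷_) (distincts k))

    without-1+k : sumₛ (term w ∘ (2 + k ∷_)) (distincts k) ≈
                  X (2 + k) ⊛ (distinctSum w′ k ⊕ distinctSum w k)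
    without-1+k = begin
      sumₛ (term w ∘ (2 + k ∷_)) (distincts k)
        ≈⟨ sumₛ-cong-∈ (distincts k) (λ {λs} λs∈ → begin
          term w (2 + k ∷ λs)
            ≈⟨ ·-congˡ (X (2 + k + sum λs)) (trans (cong w (trans (hooks₂-∷ (2 + k) λs)
                 (cong (_+ hooks₂ λs) (rowHooks₂-gap (distincts-≤ k λs∈))))) (w-suc (hooks₂ λs))) ⟩
          (w′ (hooks₂ λs) + w (hooks₂ λs)) · X (2 + k + sum λs)
            ≈⟨ ·-X-+ (w′ (hooks₂ λs) + w (hooks₂ λs)) (2 + k) (sum λs) ⟩
          X (2 + k) ⊛ ((w′ (hooks₂ λs) + w (hooks₂ λs)) · X (sum λs))
            ≈⟨ ⊛≈-cong ≈-refl (·-distrib-+ (w′ (hooks₂ λs)) (w (hooks₂ λs)) (X (sum λs))) ⟩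
          X (2 + k) ⊛ (term w′ λs ⊕ term w λs) ∎) ⟩
      sumₛ (λ λs → X (2 + k) ⊛ (term w′ λs ⊕ term w λs)) (distincts k)
        ≈⟨ sumₛ-⊛ˡ (λ λs → term w′ λs ⊕ term w λs) (X (2 + k)) (distincts k) ⟩
      X (2 + k) ⊛ sumₛ (λ λs → term w′ λs ⊕ term w λs) (distincts k)
        ≈⟨ ⊛≈-cong ≈-refl (sumₛ-⊕ (term w′) (term w) (distincts k)) ⟩
      X (2 + k) ⊛ (distinctSum w′ k ⊕ distinctSum w k) ∎

    with-1+k : sumₛ (term w ∘ (2 + k ∷_)) (map (1 + k ∷_) (distincts k)) ≈ X (2 + k) ⊛ u
    with-1+k = begin
      sumₛ (term w ∘ (2 + k ∷_)) (map (1 + k ∷_) (distincts k))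
        ≈⟨ sumₛ-map (term w ∘ (2 + k ∷_)) (1 + k ∷_) (distincts k) ⟩
      sumₛ (λ λs → term w (2 + k ∷ 1 + k ∷ λs)) (distincts k)
        ≈⟨ sumₛ-cong-∈ (distincts k) (λ {λs} λs∈ → begin
          term w (2 + k ∷ 1 + k ∷ λs)
            ≈⟨ ·-congˡ (X (2 + k + (1 + k + sum λs))) (cong w (trans (hooks₂-∷ (2 + k) (1 + k ∷ λs))
                 (cong (_+ hooks₂ (1 + k ∷ λs)) (rowHooks₂-consecutive (distincts-≤ k λs∈))))) ⟩
          w (hooks₂ (1 + k ∷ λs)) · X (2 + k + (1 + k + sum λs))
            ≈⟨ ·-X-+ (w (hooks₂ (1 + k ∷ λs))) (2 + k) (1 + k + sum λs) ⟩
          X (2 + k) ⊛ term w (1 + k ∷ λs) ∎) ⟩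
      sumₛ (λ λs → X (2 + k) ⊛ term w (1 + k ∷ λs)) (distincts k)
        ≈⟨ sumₛ-⊛ˡ (term w ∘ (1 + k ∷_)) (X (2 + k)) (distincts k) ⟩
      X (2 + k) ⊛ sumₛ (term w ∘ (1 + k ∷_)) (distincts k)
        ≈⟨ ⊛≈-cong ≈-refl (sumₛ-map (term w) (1 + k ∷_) (distincts k)) ⟨
      X (2 + k) ⊛ u ∎

  distinctSum-𝟘 : ∀ k → distinctSum (λ _ → 0) k ≈ 𝟘
  distinctSum-𝟘 k = zeros (distincts k)
    where
    zeros : ∀ λss → sumₛ (term λ _ → 0) λss ≈ 𝟘
    zeros []        = ≈-refl
    zeros (_ ∷ λss) = zeros λss

  distinctSum≈D₀ : ∀ k → distinctSum (λ _ → 1) k ≈ D₀ k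
  distinctSum≈D₀ zero          = coeffwise λ n → trans (+-identityʳ _) (*-identityˡ (𝟙 n))
  distinctSum≈D₀ (suc zero)    = begin
    1 · 𝟙 ⊕ (1 · X 1 ⊕ 𝟘)  ≈⟨ ⊕-cong (·-identity 𝟙) (⊕-cong (·-identity (X 1)) (≈-refl {𝟘})) ⟩
    𝟙 ⊕ (X 1 ⊕ 𝟘)          ≈⟨ solve 1 (λ p → con 1 :+ (p :+ con 0) := (con 1 :+ p) :* con 1) ≈-refl (X 1) ⟩
    (𝟙 ⊕ X 1) ⊛ 𝟙          ∎
  distinctSum≈D₀ (suc (suc k)) = begin
    distinctSum (λ _ → 1) (2 + k)
      ≈⟨ distinctSum-rec (λ _ → 1) (λ _ → 0) (λ _ → refl) k ⟩
    (𝟙 ⊕ X (2 + k)) ⊛ distinctSum (λ _ → 1) (1 + k) ⊕ X (2 + k) ⊛ distinctSum (λ _ → 0) k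
      ≈⟨ ⊕-cong (⊛≈-cong ≈-refl (distinctSum≈D₀ (suc k))) (⊛≈-cong ≈-refl (distinctSum-𝟘 k)) ⟩
    (𝟙 ⊕ X (2 + k)) ⊛ D₀ (1 + k) ⊕ X (2 + k) ⊛ 𝟘
      ≈⟨ solve 2 (λ a p → a :+ p :* con 0 := a) ≈-refl ((𝟙 ⊕ X (2 + k)) ⊛ D₀ (1 + k)) (X (2 + k)) ⟩
    D₀ (2 + k) ∎

  distinctSum≈D₁ : ∀ k → distinctSum id k ≈ D₁ k
  distinctSum≈D₁ zero          = coeffwise λ _ → refl
  distinctSum≈D₁ (suc zero)    = coeffwise λ _ → refl
  distinctSum≈D₁ (suc (suc k)) = ≈-trans (distinctSum-rec id (λ _ → 1) (λ _ → refl) k)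
    (⊕-cong (⊛≈-cong ≈-refl (distinctSum≈D₁ (suc k))) (⊛≈-cong ≈-refl (distinctSum≈D₀ k)))

  distinctSum≈D₂ : ∀ k → distinctSum (_C 2) k ≈ D₂ k
  distinctSum≈D₂ zero          = coeffwise λ _ → refl
  distinctSum≈D₂ (suc zero)    = coeffwise λ _ → refl
  distinctSum≈D₂ (suc (suc k)) = ≈-trans (distinctSum-rec (_C 2) id C₂-suc k)
    (⊕-cong (⊛≈-cong ≈-refl (distinctSum≈D₂ (suc k))) (⊛≈-cong ≈-refl (distinctSum≈D₁ k)))

-- Weighted enumeration of partitions into odd parts by multiplicities.

-- A vector lists the multiplicities of the parts 2k - 1, …, 3, 1 in this order.
expand : ∀ {k} → Vec ℕ k → List ℕ
expand []                = []
expand {suc k} (m ∷ v)   = replicate m (suc (double k)) ++ expand v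

expand-< : ∀ {k} (v : Vec ℕ k) → All (_< double k) (expand v)
expand-< []              = []
expand-< {suc k} (m ∷ v) = All.++⁺ (All.replicate⁺ m ≤-refl)
  (All.map (λ p → m≤n⇒m≤1+n (m≤n⇒m≤1+n p)) (expand-< v))

-- The argument k stands for the part 2k + 1; only the part 1 has no hook of
-- length two when it occurs once.
singleHooks : ℕ → ℕ
singleHooks zero    = 0
singleHooks (suc _) = 1

repeatedHooks : ℕ → ℕ → ℕ
repeatedHooks k zero          = 0
repeatedHooks k (suc zero)    = singleHooks k
repeatedHooks k (suc (suc _)) = suc (singleHooks k)

-- Among the copies of 2k + 1, the lowest sees a gap of at least 2, as smaller parts are odd (for
-- the part 1 its row is too short); the next one up is a repeat; all higher ones have two equal
-- rows below.
hooks₂-expand : ∀ {k} m (v : Vec ℕ k) → hooks₂ (expand (m ∷ v)) ≡ repeatedHooks k m + hooks₂ (expand v)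
hooks₂-expand zero v = refl
hooks₂-expand {zero}  (suc zero) [] = refl
hooks₂-expand {suc k} (suc zero) v  = trans (hooks₂-∷ (3 + double k) (expand v))
  (cong (_+ hooks₂ (expand v)) (rowHooks₂-gap (All.map ≤-pred (expand-< v))))
hooks₂-expand {k} (suc (suc zero)) v = trans (hooks₂-∷ (suc (double k)) (expand (1 ∷ v)))
  (cong₂ _+_ (rowHooks₂-repeat (All.map <⇒≤ (expand-< v))) (hooks₂-expand 1 v))
hooks₂-expand {k} (suc (suc (suc m))) v = trans (hooks₂-∷ (suc (double k)) (expand (suc (suc m) ∷ v)))
  (cong₂ _+_ (rowHooks₂-triple (suc (double k)) (expand (m ∷ v))) (hooks₂-expand (suc (suc m)) v))

sum-expand : ∀ {k} m (v : Vec ℕ k) → sum (expand (m ∷ v)) ≡ m * suc (double k) + sum (expand v)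
sum-expand zero    v = refl
sum-expand {k} (suc m) v = trans (cong (suc (double k) +_) (sum-expand m v))
  (sym (+-assoc (suc (double k)) (m * suc (double k)) (sum (expand v))))

vecs : ℕ → ∀ k → List (Vec ℕ k)
vecs M zero    = [] ∷ []
vecs M (suc k) = cartesianProductWith _∷_ (upTo M) (vecs M k)

partTerm : (ℕ → ℕ) → ℕ → ℕ → Series
partTerm w k m = w (repeatedHooks k m) · X (m * suc (double k))

sumₛ-bilinear : ∀ {A B : Set} (φ : A → Series) (ψ : B → Series) as bs →
  sumₛ (λ a → sumₛ (λ b → φ a ⊛ ψ b) bs) as ≈ sumₛ φ as ⊛ sumₛ ψ bs
sumₛ-bilinear φ ψ as bs =
  ≈-trans (sumₛ-cong as (λ a → sumₛ-⊛ˡ ψ (φ a) bs)) (sumₛ-⊛ʳ φ (sumₛ ψ bs) as)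

sumₛ-⊕₂ : ∀ {A B : Set} (φ ψ : A → B → Series) as bs →
  sumₛ (λ a → sumₛ (λ b → φ a b ⊕ ψ a b) bs) as ≈
  sumₛ (λ a → sumₛ (φ a) bs) as ⊕ sumₛ (λ a → sumₛ (ψ a) bs) as
sumₛ-⊕₂ φ ψ as bs =
  ≈-trans (sumₛ-cong as (λ a → sumₛ-⊕ (φ a) (ψ a) bs)) (sumₛ-⊕ _ _ as)

module _ (M : ℕ) where
  open ≈-Reasoning

  oddSum partSum : (ℕ → ℕ) → ℕ → Series
  oddSum w k  = sumₛ (term w ∘ expand) (vecs M k)
  partSum w k = sumₛ (partTerm w k) (upTo M)

  private
    term-expand : ∀ w {k} m (v : Vec ℕ k) {a} → w (repeatedHooks k m + hooks₂ (expand v)) ≡ a →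
      term w (expand (m ∷ v)) ≈ a · (X (m * suc (double k)) ⊛ X (sum (expand v)))
    term-expand w {k} m v {a} p = begin
      w (hooks₂ (expand (m ∷ v))) · X (sum (expand (m ∷ v)))
        ≈⟨ ·-congˡ (X (sum (expand (m ∷ v)))) (trans (cong w (hooks₂-expand m v)) p) ⟩
      a · X (sum (expand (m ∷ v)))
        ≈⟨ ·-congʳ a (CommutativeSemiring.reflexive series (cong X (sum-expand m v))) ⟩
      a · X (m * suc (double k) + sum (expand v))
        ≈⟨ ·-congʳ a (X-+ (m * suc (double k)) (sum (expand v))) ⟩
      a · (X (m * suc (double k)) ⊛ X (sum (expand v))) ∎

  oddSum₀-suc : ∀ k → oddSum (λ _ → 1) (suc k) ≈ partSum (λ _ → 1) k ⊛ oddSum (λ _ → 1) k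
  oddSum₀-suc k = begin
    oddSum (λ _ → 1) (suc k)
      ≈⟨ sumₛ-cartesianProductWith (term (λ _ → 1) ∘ expand) _∷_ (upTo M) (vecs M k) ⟩
    sumₛ (λ m → sumₛ (λ v → term (λ _ → 1) (expand (m ∷ v))) (vecs M k)) (upTo M)
      ≈⟨ sumₛ-cong (upTo M) (λ m → sumₛ-cong (vecs M k) (λ v →
           ≈-trans (term-expand (λ _ → 1) m v refl) (·-⊛-interchange 1 1 _ _))) ⟩
    sumₛ (λ m → sumₛ (λ v → partTerm (λ _ → 1) k m ⊛ term (λ _ → 1) (expand v)) (vecs M k)) (upTo M)
      ≈⟨ sumₛ-bilinear (partTerm (λ _ → 1) k) (term (λ _ → 1) ∘ expand) (upTo M) (vecs M k) ⟩
    partSum (λ _ → 1) k ⊛ oddSum (λ _ → 1) k ∎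

  oddSum₁-suc : ∀ k → oddSum id (suc k) ≈
    partSum id k ⊛ oddSum (λ _ → 1) k ⊕ partSum (λ _ → 1) k ⊛ oddSum id k
  oddSum₁-suc k = begin
    oddSum id (suc k)
      ≈⟨ sumₛ-cartesianProductWith (term id ∘ expand) _∷_ (upTo M) (vecs M k) ⟩
    sumₛ (λ m → sumₛ (λ v → term id (expand (m ∷ v))) (vecs M k)) (upTo M)
      ≈⟨ sumₛ-cong (upTo M) (λ m → sumₛ-cong (vecs M k) (split m)) ⟩
    sumₛ (λ m → sumₛ (λ v → φ m v ⊕ ψ m v) (vecs M k)) (upTo M)
      ≈⟨ sumₛ-⊕₂ φ ψ (upTo M) (vecs M k) ⟩
    sumₛ (λ m → sumₛ (φ m) (vecs M k)) (upTo M) ⊕ sumₛ (λ m → sumₛ (ψ m) (vecs M k)) (upTo M)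
      ≈⟨ ⊕-cong (sumₛ-bilinear (partTerm id k) (term (λ _ → 1) ∘ expand) (upTo M) (vecs M k))
                (sumₛ-bilinear (partTerm (λ _ → 1) k) (term id ∘ expand) (upTo M) (vecs M k)) ⟩
    partSum id k ⊛ oddSum (λ _ → 1) k ⊕ partSum (λ _ → 1) k ⊛ oddSum id k ∎
    where
    φ ψ : ℕ → Vec ℕ k → Series
    φ m v = partTerm id k m ⊛ term (λ _ → 1) (expand v)
    ψ m v = partTerm (λ _ → 1) k m ⊛ term id (expand v)
    split : ∀ m v → term id (expand (m ∷ v)) ≈ φ m v ⊕ ψ m v
    split m v = begin
      term id (expand (m ∷ v))
        ≈⟨ term-expand id m v (sym (cong₂ _+_ (*-identityʳ a) (*-identityˡ b))) ⟩
      (a * 1 + 1 * b) · (f ⊛ g)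
        ≈⟨ ·-distrib-+ (a * 1) (1 * b) (f ⊛ g) ⟩
      (a * 1) · (f ⊛ g) ⊕ (1 * b) · (f ⊛ g)
        ≈⟨ ⊕-cong (·-⊛-interchange a 1 f g) (·-⊛-interchange 1 b f g) ⟩
      φ m v ⊕ ψ m v ∎
      where
      a = repeatedHooks k m
      b = hooks₂ (expand v)
      f = X (m * suc (double k))
      g = X (sum (expand v))

  oddSum₂-suc : ∀ k → oddSum (_C 2) (suc k) ≈
    partSum (_C 2) k ⊛ oddSum (λ _ → 1) k ⊕ partSum id k ⊛ oddSum id k
      ⊕ partSum (λ _ → 1) k ⊛ oddSum (_C 2) k
  oddSum₂-suc k = begin
    oddSum (_C 2) (suc k)
      ≈⟨ sumₛ-cartesianProductWith (term (_C 2) ∘ expand) _∷_ (upTo M) (vecs M k) ⟩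
    sumₛ (λ m → sumₛ (λ v → term (_C 2) (expand (m ∷ v))) (vecs M k)) (upTo M)
      ≈⟨ sumₛ-cong (upTo M) (λ m → sumₛ-cong (vecs M k) (split m)) ⟩
    sumₛ (λ m → sumₛ (λ v → φ m v ⊕ ψ m v ⊕ χ m v) (vecs M k)) (upTo M)
      ≈⟨ ≈-trans (sumₛ-⊕₂ (λ m v → φ m v ⊕ ψ m v) χ (upTo M) (vecs M k))
                 (⊕-cong (sumₛ-⊕₂ φ ψ (upTo M) (vecs M k)) ≈-refl) ⟩
    sumₛ (λ m → sumₛ (φ m) (vecs M k)) (upTo M) ⊕ sumₛ (λ m → sumₛ (ψ m) (vecs M k)) (upTo M)
      ⊕ sumₛ (λ m → sumₛ (χ m) (vecs M k)) (upTo M)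
      ≈⟨ ⊕-cong (⊕-cong
           (sumₛ-bilinear (partTerm (_C 2) k) (term (λ _ → 1) ∘ expand) (upTo M) (vecs M k))
           (sumₛ-bilinear (partTerm id k) (term id ∘ expand) (upTo M) (vecs M k)))
           (sumₛ-bilinear (partTerm (λ _ → 1) k) (term (_C 2) ∘ expand) (upTo M) (vecs M k)) ⟩
    partSum (_C 2) k ⊛ oddSum (λ _ → 1) k ⊕ partSum id k ⊛ oddSum id k
      ⊕ partSum (λ _ → 1) k ⊛ oddSum (_C 2) k ∎
    where
    φ ψ χ : ℕ → Vec ℕ k → Series
    φ m v = partTerm (_C 2) k m ⊛ term (λ _ → 1) (expand v)
    ψ m v = partTerm id k m ⊛ term id (expand v)
    χ m v = partTerm (λ _ → 1) k m ⊛ term (_C 2) (expand v)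
    split : ∀ m v → term (_C 2) (expand (m ∷ v)) ≈ φ m v ⊕ ψ m v ⊕ χ m v
    split m v = begin
      term (_C 2) (expand (m ∷ v))
        ≈⟨ term-expand (_C 2) m v (trans (C₂-+ a b)
             (sym (cong₂ (λ s t → s + a * b + t) (*-identityʳ (a C 2)) (*-identityˡ (b C 2))))) ⟩
      ((a C 2) * 1 + a * b + 1 * (b C 2)) · (f ⊛ g)
        ≈⟨ ≈-trans (·-distrib-+ ((a C 2) * 1 + a * b) (1 * (b C 2)) (f ⊛ g))
                   (⊕-cong (·-distrib-+ ((a C 2) * 1) (a * b) (f ⊛ g)) ≈-refl) ⟩
      ((a C 2) * 1) · (f ⊛ g) ⊕ (a * b) · (f ⊛ g) ⊕ (1 * (b C 2)) · (f ⊛ g)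
        ≈⟨ ⊕-cong (⊕-cong (·-⊛-interchange (a C 2) 1 f g) (·-⊛-interchange a b f g))
                  (·-⊛-interchange 1 (b C 2) f g) ⟩
      φ m v ⊕ ψ m v ⊕ χ m v ∎
      where
      a = repeatedHooks k m
      b = hooks₂ (expand v)
      f = X (m * suc (double k))
      g = X (sum (expand v))

  -- Capped multiplicities and the lower bound for the odd side.

  partialGeo : ℕ → Series
  partialGeo s = sumₛ (λ m → X (m * s)) (upTo M)

sumₛ-applyUpTo : ∀ (φ : ℕ → Series) f n → sumₛ φ (applyUpTo f n) ≈ sumₛ (φ ∘ f) (upTo n)
sumₛ-applyUpTo φ f n = ≈-trans
  (CommutativeSemiring.reflexive series (cong (sumₛ φ) (sym (map-upTo f n))))
  (sumₛ-map φ f (upTo n))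

partialGeo-suc : ∀ s n → partialGeo (suc n) s ≈ 𝟙 ⊕ X s ⊛ partialGeo n s
partialGeo-suc s n = ⊕-cong {𝟙} ≈-refl (begin
  sumₛ (λ m → X (m * s)) (applyUpTo suc n)    ≈⟨ sumₛ-applyUpTo (λ m → X (m * s)) suc n ⟩
  sumₛ (λ m → X (s + m * s)) (upTo n)         ≈⟨ sumₛ-cong (upTo n) (λ m → X-+ s (m * s)) ⟩
  sumₛ (λ m → X s ⊛ X (m * s)) (upTo n)       ≈⟨ sumₛ-⊛ˡ (λ m → X (m * s)) (X s) (upTo n) ⟩
  X s ⊛ partialGeo n s                        ∎)
  where open ≈-Reasoning

geo-partial : ∀ s n → geo (suc s) ≈ partialGeo n (suc s) ⊕ X (n * suc s) ⊛ geo (suc s)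
geo-partial s zero    = solve 1 (λ g → g := con 0 :+ con 1 :* g) ≈-refl (geo (suc s))
geo-partial s (suc n) = begin
  g                                                          ≈⟨ geo-unfold s ⟩
  𝟙 ⊕ X (suc s) ⊛ g                                          ≈⟨ ⊕-cong {𝟙} ≈-refl (⊛≈-cong ≈-refl (geo-partial s n)) ⟩
  𝟙 ⊕ X (suc s) ⊛ (partialGeo n (suc s) ⊕ X (n * suc s) ⊛ g)
    ≈⟨ solve 4 (λ p r t g → con 1 :+ p :* (r :+ t :* g) := con 1 :+ p :* r :+ p :* t :* g)
         ≈-refl (X (suc s)) (partialGeo n (suc s)) (X (n * suc s)) g ⟩
  𝟙 ⊕ X (suc s) ⊛ partialGeo n (suc s) ⊕ X (suc s) ⊛ X (n * suc s) ⊛ g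
    ≈⟨ ⊕-cong (partialGeo-suc (suc s) n) (⊛≈-cong {x = X (suc n * suc s)} (X-+ (suc s) (n * suc s)) ≈-refl) ⟨
  partialGeo (suc n) (suc s) ⊕ X (suc n * suc s) ⊛ g         ∎
  where
  open ≈-Reasoning
  g = geo (suc s)

-- Multiplicities 0 and 1 are split off, since the number of hooks is constant from 2 on.
partSum-unfold : ∀ w k n → let s = suc (double k) in
  partSum (2 + n) w k ≈
  w 0 · 𝟙 ⊕ (w (singleHooks k) · X s ⊕ w (suc (singleHooks k)) · (X s ⊛ X s ⊛ partialGeo n s))
partSum-unfold w k n = ⊕-cong {w 0 · 𝟙} ≈-refl (⊕-cong
  (·-congʳ (w (singleHooks k)) (CommutativeSemiring.reflexive series (cong X (+-identityʳ s))))
  (begin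
    sumₛ (partTerm w k) (applyUpTo (suc ∘ suc) n)
      ≈⟨ sumₛ-applyUpTo (partTerm w k) (suc ∘ suc) n ⟩
    sumₛ (λ m → a · X (s + (s + m * s))) (upTo n)
      ≈⟨ sumₛ-cong (upTo n) (λ m → begin
           a · X (s + (s + m * s))             ≈⟨ ·-congʳ a (≈-trans (X-+ s (s + m * s)) (⊛≈-cong ≈-refl (X-+ s (m * s)))) ⟩
           a · (X s ⊛ (X s ⊛ X (m * s)))       ≈⟨ ·-congʳ a (CommutativeSemiring.*-assoc series (X s) (X s) (X (m * s))) ⟨
           a · (X s ⊛ X s ⊛ X (m * s))         ≈⟨ coeffwise (·-⊛ a (X s ⊛ X s) (X (m * s))) ⟨
           a · (X s ⊛ X s) ⊛ X (m * s)         ∎) ⟩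
    sumₛ (λ m → (a · (X s ⊛ X s)) ⊛ X (m * s)) (upTo n)
      ≈⟨ sumₛ-⊛ˡ (λ m → X (m * s)) (a · (X s ⊛ X s)) (upTo n) ⟩
    (a · (X s ⊛ X s)) ⊛ partialGeo n s
      ≈⟨ coeffwise (·-⊛ a (X s ⊛ X s) (partialGeo n s)) ⟩
    a · (X s ⊛ X s ⊛ partialGeo n s) ∎))
  where
  open ≈-Reasoning
  s = suc (double k)
  a = w (suc (singleHooks k))

module OddLowerBound (N : ℕ) where

  open Truncated N
  open PreorderReasoning ≼-preorder

  private
    -- Beyond the multiplicities 0 and 1 this leaves N + 1 terms of the geometric series, which
    -- reach every degree up to N.
    M = 3 + N

  geo≼partialGeo : ∀ s → geo (suc s) ≼ partialGeo (suc N) (suc s)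
  geo≼partialGeo s = coeffwise-≤ λ n n≤N → ≤-reflexive (trans (coeff (geo-partial s (suc N)) n)
    (trans (cong (partialGeo (suc N) (suc s) n +_)
             (X-coeff-< (geo (suc s)) (≤-trans (s≤s n≤N) (m≤m*n (suc N) (suc s)))))
           (+-identityʳ _)))

  private
    tail : ∀ s → X (suc s) ⊛ X (suc s) ⊛ geo (suc s) ≼ X (suc s) ⊛ X (suc s) ⊛ partialGeo (suc N) (suc s)
    tail s = ⊛-mono ≼-refl (geo≼partialGeo s)

  partSum₀≽ : ∀ k → geo (suc (double k)) ≼ partSum M (λ _ → 1) k
  partSum₀≽ k = begin
    g
      ≈⟨ ≈-trans (geo-unfold (double k)) (⊕-cong {𝟙} ≈-refl (⊛≈-cong ≈-refl (geo-unfold (double k)))) ⟩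
    𝟙 ⊕ p ⊛ (𝟙 ⊕ p ⊛ g)
      ≈⟨ solve 2 (λ p g → con 1 :+ p :* (con 1 :+ p :* g) := con 1 :+ (p :+ p :* p :* g)) ≈-refl p g ⟩
    𝟙 ⊕ (p ⊕ p ⊛ p ⊛ g)
      ≲⟨ ⊕-mono {𝟙} ≼-refl (⊕-mono {p} ≼-refl (tail (double k))) ⟩
    𝟙 ⊕ (p ⊕ p ⊛ p ⊛ h)
      ≈⟨ ⊕-cong (·-identity 𝟙) (⊕-cong (·-identity p) (·-identity (p ⊛ p ⊛ h))) ⟨
    1 · 𝟙 ⊕ (1 · p ⊕ 1 · (p ⊛ p ⊛ h))
      ≈⟨ partSum-unfold (λ _ → 1) k (suc N) ⟨
    partSum M (λ _ → 1) k ∎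
    where
    p = X (suc (double k))
    g = geo (suc (double k))
    h = partialGeo (suc N) (suc (double k))

  -- The origin of `y`: for s ≥ 3, one hook for a single copy and two for more give q^s + 2
  -- q^(2s)/(1 - q^s) = (q^s + q^(2s))/(1 - q^s), while the part 1 gives q^2/(1 - q).
  partSum₁≽ : ∀ k → geo (suc (double k)) ⊛ y k ≼ partSum M id k
  partSum₁≽ zero = begin
    g ⊛ X 2
      ≈⟨ solve 2 (λ q g → g :* (2 ▹ con 1) q := (1 ▹ con 1) q :* (1 ▹ con 1) q :* g) ≈-refl q g ⟩
    p ⊛ p ⊛ g
      ≲⟨ tail 0 ⟩
    p ⊛ p ⊛ h
      ≈⟨ (coeffwise λ n → sym (+-identityʳ ((p ⊛ p ⊛ h) n))) ⟩
    0 · 𝟙 ⊕ (0 · p ⊕ 1 · (p ⊛ p ⊛ h))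
      ≈⟨ partSum-unfold id 0 (suc N) ⟨
    partSum M id 0 ∎
    where
    p = X 1
    g = geo 1
    h = partialGeo (suc N) 1
  partSum₁≽ (suc k) = begin
    g ⊛ (p ⊕ X (double s))
      ≈⟨ solve 3 (λ g p r → g :* (p :+ r) := p :* g :+ r :* g) ≈-refl g p (X (double s)) ⟩
    p ⊛ g ⊕ X (double s) ⊛ g
      ≈⟨ ⊕-cong (⊛≈-cong ≈-refl (geo-unfold (2 + double k))) (⊛≈-cong (X-double s) ≈-refl) ⟩
    p ⊛ (𝟙 ⊕ p ⊛ g) ⊕ p ⊛ p ⊛ g
      ≈⟨ solve 2 (λ p g → p :* (con 1 :+ p :* g) :+ p :* p :* g := p :+ (p :* p :* g :+ p :* p :* g)) ≈-refl p g ⟩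
    p ⊕ (p ⊛ p ⊛ g ⊕ p ⊛ p ⊛ g)
      ≲⟨ ⊕-mono {p} ≼-refl (⊕-mono (tail (2 + double k)) (tail (2 + double k))) ⟩
    p ⊕ (p ⊛ p ⊛ h ⊕ p ⊛ p ⊛ h)
      ≈⟨ (coeffwise λ n → cong₂ _+_ (sym (*-identityˡ (p n)))
           (cong ((p ⊛ p ⊛ h) n +_) (sym (*-identityˡ ((p ⊛ p ⊛ h) n))))) ⟩
    0 · 𝟙 ⊕ (1 · p ⊕ 2 · (p ⊛ p ⊛ h))
      ≈⟨ partSum-unfold id (suc k) (suc N) ⟨
    partSum M id (suc k) ∎
    where
    s = 3 + double k
    p = X s
    g = geo s
    h = partialGeo (suc N) s

  -- The origin of `z`: a part s ≥ 3 owns a pair of hooks by itself exactly when it is repeated,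
  -- which gives q^(2s)/(1 - q^s).
  partSum₂≽ : ∀ k → geo (suc (double k)) ⊛ z k ≼ partSum M (_C 2) k
  partSum₂≽ zero = begin
    geo 1 ⊛ 𝟘           ≈⟨ CommutativeSemiring.zeroʳ series (geo 1) ⟩
    𝟘                   ≲⟨ f≼f⊕g 𝟘 _ ⟩
    partSum M (_C 2) 0  ∎
  partSum₂≽ (suc k) = begin
    g ⊛ X (double s)
      ≈⟨ ≈-trans (CommutativeSemiring.*-comm series g _) (⊛≈-cong (X-double s) ≈-refl) ⟩
    p ⊛ p ⊛ g
      ≲⟨ tail (2 + double k) ⟩
    p ⊛ p ⊛ h
      ≈⟨ (coeffwise λ n → sym (+-identityʳ ((p ⊛ p ⊛ h) n))) ⟩
    0 · 𝟙 ⊕ (0 · p ⊕ 1 · (p ⊛ p ⊛ h))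
      ≈⟨ partSum-unfold (_C 2) (suc k) (suc N) ⟨
    partSum M (_C 2) (suc k) ∎
    where
    s = 3 + double k
    p = X s
    g = geo s
    h = partialGeo (suc N) s

  oddSum₀≽ : ∀ k → oddProduct k ≼ oddSum M (λ _ → 1) k
  oddSum₀≽ zero    = coeffwise-≤ λ n _ → ≤-reflexive (sym (trans (+-identityʳ _) (*-identityˡ (𝟙 n))))
  oddSum₀≽ (suc k) = begin
    oddProduct k ⊛ geo (suc (double k))                   ≲⟨ ⊛-mono (oddSum₀≽ k) (partSum₀≽ k) ⟩
    oddSum M (λ _ → 1) k ⊛ partSum M (λ _ → 1) k          ≈⟨ CommutativeSemiring.*-comm series _ _ ⟩
    partSum M (λ _ → 1) k ⊛ oddSum M (λ _ → 1) k          ≈⟨ oddSum₀-suc M k ⟨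
    oddSum M (λ _ → 1) (suc k)                            ∎

  oddSum₁≽ : ∀ k → oddProduct k ⊛ e₁ k ≼ oddSum M id k
  oddSum₁≽ zero    = ≼-trans (Preorder.reflexive ≼-preorder (CommutativeSemiring.zeroʳ series 𝟙)) (f≼f⊕g 𝟘 _)
  oddSum₁≽ (suc k) = begin
    oddProduct k ⊛ g ⊛ (e₁ k ⊕ y k)
      ≈⟨ solve 4 (λ o g e y → o :* g :* (e :+ y) := g :* y :* o :+ g :* (o :* e)) ≈-refl
           (oddProduct k) g (e₁ k) (y k) ⟩
    g ⊛ y k ⊛ oddProduct k ⊕ g ⊛ (oddProduct k ⊛ e₁ k)
      ≲⟨ ⊕-mono (⊛-mono (partSum₁≽ k) (oddSum₀≽ k)) (⊛-mono (partSum₀≽ k) (oddSum₁≽ k)) ⟩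
    partSum M id k ⊛ oddSum M (λ _ → 1) k ⊕ partSum M (λ _ → 1) k ⊛ oddSum M id k
      ≈⟨ oddSum₁-suc M k ⟨
    oddSum M id (suc k) ∎
    where g = geo (suc (double k))

  oddSum₂≽ : ∀ k → oddProduct k ⊛ e₂ k ≼ oddSum M (_C 2) k
  oddSum₂≽ zero    = ≼-trans (Preorder.reflexive ≼-preorder (CommutativeSemiring.zeroʳ series 𝟙)) (f≼f⊕g 𝟘 _)
  oddSum₂≽ (suc k) = begin
    oddProduct k ⊛ g ⊛ (e₂ k ⊕ (y k ⊛ e₁ k ⊕ z k))
      ≈⟨ solve 6 (λ o g e f y z → o :* g :* (f :+ (y :* e :+ z)) :=
                                  g :* z :* o :+ g :* y :* (o :* e) :+ g :* (o :* f)) ≈-refl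
           (oddProduct k) g (e₁ k) (e₂ k) (y k) (z k) ⟩
    g ⊛ z k ⊛ oddProduct k ⊕ g ⊛ y k ⊛ (oddProduct k ⊛ e₁ k) ⊕ g ⊛ (oddProduct k ⊛ e₂ k)
      ≲⟨ ⊕-mono (⊕-mono (⊛-mono (partSum₂≽ k) (oddSum₀≽ k)) (⊛-mono (partSum₁≽ k) (oddSum₁≽ k)))
                (⊛-mono (partSum₀≽ k) (oddSum₂≽ k)) ⟩
    partSum M (_C 2) k ⊛ oddSum M (λ _ → 1) k ⊕ partSum M id k ⊛ oddSum M id k
      ⊕ partSum M (λ _ → 1) k ⊛ oddSum M (_C 2) k
      ≈⟨ oddSum₂-suc M k ⟨
    oddSum M (_C 2) (suc k) ∎
    where g = geo (suc (double k))

-- Multiplicity vectors as partitions into odd parts.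

expand-sorted : ∀ {k} (v : Vec ℕ k) → AllPairs _≥_ (expand v)
expand-sorted []                    = []
expand-sorted {suc k} (zero ∷ v)    = expand-sorted v
expand-sorted {suc k} (suc m ∷ v)   = All.map ≤-pred (expand-< (m ∷ v)) ∷ expand-sorted (m ∷ v)

expand-positive : ∀ {k} (v : Vec ℕ k) → All (0 <_) (expand v)
expand-positive []                = []
expand-positive {suc k} (m ∷ v)   = All.++⁺ (All.replicate⁺ m (s≤s z≤n)) (expand-positive v)

2∤1+double : ∀ k → ¬ 2 ∣ suc (double k)
2∤1+double zero    = >⇒∤ ≤-refl
2∤1+double (suc k) = λ 2∣ → 2∤1+double k (∣m+n∣m⇒∣n 2∣ ∣-refl)

expand-odd : ∀ {k} (v : Vec ℕ k) → All (2 ∤_) (expand v)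
expand-odd []                = []
expand-odd {suc k} (m ∷ v)   = All.++⁺ (All.replicate⁺ m (2∤1+double k)) (expand-odd v)

-- The leading multiplicity can be read off, because every later part is smaller by `expand-<`.
expand-injective : ∀ {k} {v w : Vec ℕ k} → expand v ≡ expand w → v ≡ w
expand-injective {v = []}        {[]}        _  = refl
expand-injective {v = zero ∷ v}  {zero ∷ w}  eq = cong (zero ∷_) (expand-injective eq)
expand-injective {v = zero ∷ v}  {suc m ∷ w} eq with subst (All _) eq (expand-< v)
... | p ∷ _ = contradiction p (≤⇒≯ (n≤1+n _))
expand-injective {v = suc m ∷ v} {zero ∷ w}  eq with subst (All _) (sym eq) (expand-< w)
... | p ∷ _ = contradiction p (≤⇒≯ (n≤1+n _))
expand-injective {v = suc m ∷ v} {suc l ∷ w} eq with expand-injective {v = m ∷ v} {l ∷ w} (∷-injectiveʳ eq)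
... | refl = refl

vecs-unique : ∀ M k → Unique (vecs M k)
vecs-unique M zero    = [] ∷ []
vecs-unique M (suc k) =
  Unique.cartesianProductWith⁺ _∷_ Vec.∷-injective (Unique.upTo⁺ M) (vecs-unique M k)

-- Sums over the number of hooks as sums over partitions.

X-coeff-suc : ∀ m n → X (suc m) (suc n) ≡ X m n
X-coeff-suc m = ⊛-identityˡ (X m)

X-coeff-diag : ∀ n → X n n ≡ 1
X-coeff-diag zero    = refl
X-coeff-diag (suc n) = trans (X-coeff-suc n n) (X-coeff-diag n)

X-coeff-≢ : ∀ {m n} → m ≢ n → X m n ≡ 0
X-coeff-≢ {zero}  {zero}  m≢n = contradiction refl m≢n
X-coeff-≢ {zero}  {suc n} m≢n = refl
X-coeff-≢ {suc m} {zero}  m≢n = refl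
X-coeff-≢ {suc m} {suc n} m≢n = trans (X-coeff-suc m n) (X-coeff-≢ (m≢n ∘ cong suc))

sum-applyUpTo-cong : ∀ {f g : ℕ → ℕ} → (∀ m → f m ≡ g m) → ∀ n → sum (applyUpTo f n) ≡ sum (applyUpTo g n)
sum-applyUpTo-cong p zero    = refl
sum-applyUpTo-cong p (suc n) = cong₂ _+_ (p 0) (sum-applyUpTo-cong (p ∘ suc) n)

sum-applyUpTo-+ : ∀ (f g : ℕ → ℕ) n →
  sum (applyUpTo (λ m → f m + g m) n) ≡ sum (applyUpTo f n) + sum (applyUpTo g n)
sum-applyUpTo-+ f g zero    = refl
sum-applyUpTo-+ f g (suc n) = trans
  (cong (f 0 + g 0 +_) (sum-applyUpTo-+ (f ∘ suc) (g ∘ suc) n))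
  (interchange (f 0) (g 0) _ _)
  where open import Algebra.Properties.CommutativeSemigroup +-commutativeSemigroup using (interchange)

sum-applyUpTo-0 : ∀ {f : ℕ → ℕ} → (∀ m → f m ≡ 0) → ∀ n → sum (applyUpTo f n) ≡ 0
sum-applyUpTo-0 p zero    = refl
sum-applyUpTo-0 p (suc n) = cong₂ _+_ (p 0) (sum-applyUpTo-0 (p ∘ suc) n)

-- Here `X t m` serves as the Kronecker delta.
sum-applyUpTo-X : ∀ (w : ℕ → ℕ) {t n} → t < n → sum (applyUpTo (λ m → w m * X t m) n) ≡ w t
sum-applyUpTo-X w {zero}  {suc n} _         = trans
  (cong₂ _+_ (*-identityʳ (w 0)) (sum-applyUpTo-0 (λ m → *-zeroʳ (w (suc m))) n))
  (+-identityʳ (w 0))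
sum-applyUpTo-X w {suc t} {suc n} (s≤s t<n) = cong₂ _+_ (*-zeroʳ (w 0)) (trans
  (sum-applyUpTo-cong (λ m → cong (w (suc m) *_) (X-coeff-suc t m)) n)
  (sum-applyUpTo-X (w ∘ suc) t<n))

module _ {A : Set} {P : Pred A 0ℓ} (P? : Decidable P) (h : A → ℕ) where

  level? : ∀ m → Decidable (λ a → P a × h a ≡ m)
  level? m a = P? a ×-dec (h a ≟ m)

  length-filter-level : ∀ {a} as → P a → ∀ m →
    length (filter (level? m) (a ∷ as)) ≡ X (h a) m + length (filter (level? m) as)
  length-filter-level {a} as Pa m with h a ≟ m
  ... | yes refl = trans (cong length (filter-accept (level? m) {xs = as} (Pa , refl)))
                     (cong (_+ length (filter (level? m) as)) (sym (X-coeff-diag m)))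
  ... | no  h≢m  = trans (cong length (filter-reject (level? m) {xs = as} (h≢m ∘ proj₂)))
                     (cong (_+ length (filter (level? m) as)) (sym (X-coeff-≢ h≢m)))

  -- Double counting: an element satisfying `P` lies on exactly one level, and the bound puts that
  -- level in the range.
  sum-levels : ∀ (w : ℕ → ℕ) {n} as → All (λ a → h a < n) as →
    sum (applyUpTo (λ m → w m * length (filter (level? m) as)) n) ≡ sum (map (w ∘ h) (filter P? as))
  sum-levels w {n} []       []         = sum-applyUpTo-0 (λ m → *-zeroʳ (w m)) n
  sum-levels w {n} (a ∷ as) (ha<n ∷ p) = by-cases (P? a)
    where
    open ≡-Reasoning
    rest : ℕ → ℕ
    rest m = length (filter (level? m) as)
    by-cases : Dec (P a) → sum (applyUpTo (λ m → w m * length (filter (level? m) (a ∷ as))) n) ≡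
                           sum (map (w ∘ h) (filter P? (a ∷ as)))
    by-cases (yes Pa) = begin
      sum (applyUpTo (λ m → w m * length (filter (level? m) (a ∷ as))) n)
        ≡⟨ sum-applyUpTo-cong (λ m → trans (cong (w m *_) (length-filter-level as Pa m))
             (*-distribˡ-+ (w m) (X (h a) m) (rest m))) n ⟩
      sum (applyUpTo (λ m → w m * X (h a) m + w m * rest m) n)
        ≡⟨ sum-applyUpTo-+ (λ m → w m * X (h a) m) (λ m → w m * rest m) n ⟩
      sum (applyUpTo (λ m → w m * X (h a) m) n) + sum (applyUpTo (λ m → w m * rest m) n)
        ≡⟨ cong₂ _+_ (sum-applyUpTo-X w ha<n) (sum-levels w as p) ⟩
      sum (map (w ∘ h) (a ∷ filter P? as))
        ≡⟨ cong (sum ∘ map (w ∘ h)) (filter-accept P? Pa) ⟨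
      sum (map (w ∘ h) (filter P? (a ∷ as))) ∎
    by-cases (no ¬Pa) = begin
      sum (applyUpTo (λ m → w m * length (filter (level? m) (a ∷ as))) n)
        ≡⟨ sum-applyUpTo-cong (λ m → cong (λ l → w m * length l)
             (filter-reject (level? m) {xs = as} (¬Pa ∘ proj₁))) n ⟩
      sum (applyUpTo (λ m → w m * rest m) n)
        ≡⟨ sum-levels w as p ⟩
      sum (map (w ∘ h) (filter P? as))
        ≡⟨ cong (sum ∘ map (w ∘ h)) (filter-reject P? ¬Pa) ⟨
      sum (map (w ∘ h) (filter P? (a ∷ as))) ∎

∑-count : ∀ (w : ℕ → ℕ) {P : Pred (List ℕ) 0ℓ} (P? : Decidable P) n →
  ∑ (λ m → w m * count P? m n) (weighted-support w P? n) ≡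
  sum (map (w ∘ hooks₂) (filter P? (partitions n)))
∑-count w P? n = trans (cong sum (map-upTo (λ m → w m * count P? m n) (suc n)))
  (sum-levels P? hooks₂ w (partitions n) (All.tabulate λ {λs} λs∈ →
    s≤s (subst (hooks₂ λs ≤_) (proj₂ (proj₂ (partitions-sound {n} λs∈))) (hooks₂≤sum λs))))

-- Comparison of sums over lists, and the conclusion.

-- Each matched element is removed from `bs`; uniqueness keeps the others available. Elements of
-- weight 0 are exempt, which disposes of the vectors whose partition has a sum other than n.
sum-map-⊆ : ∀ {A : Set} (u : A → ℕ) {as} bs → Unique as → (∀ {a} → a ∈ as → u a ≢ 0 → a ∈ bs) →
            sum (map u as) ≤ sum (map u bs)
sum-map-⊆ u {[]}     bs _              _  = z≤n
sum-map-⊆ u {a ∷ as} bs (a∉as ∷ uniq) as⊆ with u a ≟ 0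
... | yes ua≡0 = subst (λ i → i + sum (map u as) ≤ sum (map u bs)) (sym ua≡0)
                   (sum-map-⊆ u bs uniq (as⊆ ∘ there))
... | no  ua≢0 with ∈-∃++ (as⊆ (here refl) ua≢0)
...   | bs₁ , bs₂ , refl = begin
  u a + sum (map u as)             ≤⟨ +-monoʳ-≤ (u a) (sum-map-⊆ u (bs₁ ++ bs₂) uniq as⊆′) ⟩
  sum (map u (a ∷ bs₁ ++ bs₂))     ≡⟨ sum-↭ (Perm.map⁺ u (Perm.shift a bs₁ bs₂)) ⟨
  sum (map u (bs₁ ++ a ∷ bs₂))     ∎
  where
  open ≤-Reasoning
  as⊆′ : ∀ {b} → b ∈ as → u b ≢ 0 → b ∈ bs₁ ++ bs₂
  as⊆′ b∈ ub≢0 with Perm.∈-resp-↭ (Perm.shift a bs₁ bs₂) (as⊆ (there b∈) ub≢0)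
  ... | here refl = contradiction refl (All.lookup a∉as b∈)
  ... | there b∈′ = b∈′

sum-partitions : ∀ (w : ℕ → ℕ) {P : Pred (List ℕ) 0ℓ} (P? : Decidable P) n →
  sum (map (w ∘ hooks₂) (filter P? (partitions n))) ≡
  sum (map (λ λs → term w λs n) (filter P? (partitions n)))
sum-partitions w P? n = cong sum (map-cong-local (All.tabulate weight))
  where
  weight : ∀ {λs} → λs ∈ filter P? (partitions n) → w (hooks₂ λs) ≡ term w λs n
  weight {λs} λs∈ with proj₂ (proj₂ (partitions-sound {n} (proj₁ (∈-filter⁻ P? λs∈))))
  ... | refl = sym (trans (cong (w (hooks₂ λs) *_) (X-coeff-diag (sum λs))) (*-identityʳ _))

double≡2* : ∀ k → double k ≡ 2 * k
double≡2* k = trans (sym (m+m≡double k)) (cong (k +_) (sym (+-identityʳ k)))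

oddSum≤ : ∀ w M L n →
  oddSum M w L n ≤ sum (map (w ∘ hooks₂) (filter (oddParts≤? (2 * L ∸ 1)) (partitions n)))
oddSum≤ w M L n = begin
  oddSum M w L n
    ≡⟨ sumₛ-coeff (term w ∘ expand) (vecs M L) n ⟩
  sum (map (λ v → term w (expand v) n) (vecs M L))
    ≡⟨ cong sum (map-∘ (vecs M L)) ⟩
  sum (map (λ λs → term w λs n) (map expand (vecs M L)))
    ≤⟨ sum-map-⊆ (λ λs → term w λs n) _ (Unique.map⁺ expand-injective (vecs-unique M L)) expand∈ ⟩
  sum (map (λ λs → term w λs n) (filter (oddParts≤? (2 * L ∸ 1)) (partitions n)))
    ≡⟨ sum-partitions w (oddParts≤? (2 * L ∸ 1)) n ⟨
  sum (map (w ∘ hooks₂) (filter (oddParts≤? (2 * L ∸ 1)) (partitions n))) ∎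
  where
  open ≤-Reasoning
  expand∈ : ∀ {λs} → λs ∈ map expand (vecs M L) → term w λs n ≢ 0 →
            λs ∈ filter (oddParts≤? (2 * L ∸ 1)) (partitions n)
  expand∈ λs∈ term≢0 with ∈-map⁻ expand λs∈
  ... | v , _ , refl with sum (expand v) ≟ n
  ...   | no  sum≢n = contradiction
            (trans (cong (w (hooks₂ (expand v)) *_) (X-coeff-≢ sum≢n)) (*-zeroʳ (w (hooks₂ (expand v))))) term≢0
  ...   | yes sum≡n = ∈-filter⁺ (oddParts≤? (2 * L ∸ 1))
            (partitions-complete (AllPairs⇒Linked (expand-sorted v) , expand-positive v , sum≡n))
            (expand-odd v , All.map (λ p → <⇒≤pred (subst (_ <_) (double≡2* L) p)) (expand-< v))

≤distinctSum : ∀ w K n →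
  sum (map (w ∘ hooks₂) (filter (distinctParts≤? K) (partitions n))) ≤ distinctSum w K n
≤distinctSum w K n = begin
  sum (map (w ∘ hooks₂) (filter (distinctParts≤? K) (partitions n)))
    ≡⟨ sum-partitions w (distinctParts≤? K) n ⟩
  sum (map (λ λs → term w λs n) (filter (distinctParts≤? K) (partitions n)))
    ≤⟨ sum-map-⊆ (λ λs → term w λs n) (distincts K)
         (Unique.filter⁺ (distinctParts≤? K) (partitions-unique n)) ∈distincts ⟩
  sum (map (λ λs → term w λs n) (distincts K))
    ≡⟨ sumₛ-coeff (term w) (distincts K) n ⟨
  distinctSum w K n ∎
  where
  open ≤-Reasoning
  ∈distincts : ∀ {λs} → λs ∈ filter (distinctParts≤? K) (partitions n) → term w λs n ≢ 0 →
               λs ∈ distincts K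
  ∈distincts λs∈ _ with ∈-filter⁻ (distinctParts≤? K) {xs = partitions n} λs∈
  ... | λs∈n , uniq , bound with partitions-sound {n} λs∈n
  ...   | sorted , pos , _ =
    distincts-complete K (Linked⇒AllPairs (λ i≥j j≥k → ≤-trans j≥k i≥j) sorted) uniq pos bound

theorem1p5 : ∀ (L n : ℕ) → L ≥ 1 →
    ∑ (λ m → (m C 2) * a₂ L m n) (a₂-support L n)
    ≥ ∑ (λ m → (m C 2) * b₂ (2 * L) m n) (b₂-support (2 * L) n)
theorem1p5 L@(suc k) n _ = begin
  ∑ (λ m → (m C 2) * b₂ (2 * L) m n) (b₂-support (2 * L) n)
    ≡⟨ ∑-count (_C 2) (distinctParts≤? (2 * L)) n ⟩
  sum (map ((_C 2) ∘ hooks₂) (filter (distinctParts≤? (2 * L)) (partitions n)))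
    ≤⟨ ≤distinctSum (_C 2) (2 * L) n ⟩
  distinctSum (_C 2) (2 * L) n
    ≡⟨ coeff (distinctSum≈D₂ (2 * L)) n ⟩
  D₂ (2 * L) n
    ≡⟨ cong (λ K → D₂ K n) (double≡2* L) ⟨
  D₂ (double L) n
    -- The truncation degree is n itself, so the coefficient of q^n is the last one still compared.
    ≤⟨ coeff-≤ (≼-trans (D₂≼ k) (oddSum₂≽ L)) n ≤-refl ⟩
  oddSum (3 + n) (_C 2) L n
    ≤⟨ oddSum≤ (_C 2) (3 + n) L n ⟩
  sum (map ((_C 2) ∘ hooks₂) (filter (oddParts≤? (2 * L ∸ 1)) (partitions n)))
    ≡⟨ ∑-count (_C 2) (oddParts≤? (2 * L ∸ 1)) n ⟨
  ∑ (λ m → (m C 2) * a₂ L m n) (a₂-support L n) ∎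
  where
  open ≤-Reasoning
  open Truncated n
  open OddLowerBound n
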